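{- For every $m\in\mathbb{N}$: (a) $E(m,1)=\left\lfloor\frac{2(m+1)}{3}\right\rfloor$; (b) $E(m,2)=\left\lfloor\frac{2(m+2)}{3}\right\rfloor$; (c) $E(m,3)=\left\lfloor\frac{2(m+3)}{3}\right\rfloor$.
   Context: $G(m,n)$ is the grid graph on $[m]\times[n]$ with edges between vertices at Euclidean distance 1. In 2-neighbour bootstrap percolation, a vertex becomes infected once at least 2 of its neighbours are infected, infected vertices stay infected; an initial set percolates if eventually all vertices are infected. A minimal percolating set is a percolating set none of whose proper subsets percolates. $E(m,n)$ is the maximum size of a minimal percolating set of $G(m,n)$. -}

module Defs where

open import Data.Nat using (ℕ; zero; suc; _+_; _≤_)
open import Data.Fin using (Fin; toℕ)
open import Data.Bool using (Bool; true; false; if_then_else_)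
open import Data.List using (List; map; allFin)
open import Data.Nat.ListAction using (sum)
open import Data.Product using (_×_; Σ; ∃; _,_)
open import Data.Sum using (_⊎_)
open import Relation.Binary.PropositionalEquality using (_≡_; _≢_)
open import Relation.Nullary using (¬_)

Vertex : ℕ → ℕ → Set
Vertex m n = Fin m × Fin n

Diff1 : ℕ → ℕ → Set
Diff1 a b = (suc a ≡ b) ⊎ (suc b ≡ a)

-- Adjacency: Euclidean distance exactly 1.
Adj : ∀ {m n} → Vertex m n → Vertex m n → Set
Adj (i , j) (i' , j') =
  (i ≡ i' × Diff1 (toℕ j) (toℕ j')) ⊎ (j ≡ j' × Diff1 (toℕ i) (toℕ i'))

VSet : ℕ → ℕ → Set
VSet m n = Vertex m n → Bool

-- Vertices eventually infected by 2-neighbour bootstrap percolation from A.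
data Infected {m n : ℕ} (A : VSet m n) : Vertex m n → Set where
  init : ∀ {v} → A v ≡ true → Infected A v
  step : ∀ {v} (u w : Vertex m n) → u ≢ w → Adj u v → Adj w v →
         Infected A u → Infected A w → Infected A v

Percolates : ∀ {m n} → VSet m n → Set
Percolates A = ∀ v → Infected A v

ProperSubset : ∀ {m n} → VSet m n → VSet m n → Set
ProperSubset {m} {n} B A =
  (∀ v → B v ≡ true → A v ≡ true) × Σ (Vertex m n) (λ v → A v ≡ true × B v ≡ false)

MinimalPercolating : ∀ {m n} → VSet m n → Set
MinimalPercolating {m} {n} A =
  Percolates A × (∀ (B : VSet m n) → ProperSubset B A → ¬ Percolates B)

size : ∀ {m n} → VSet m n → ℕ
size {m} {n} A =
  sum (map (λ i → sum (map (λ j → if A (i , j) then 1 else 0) (allFin n))) (allFin m))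

IsE : ℕ → ℕ → ℕ → Set
IsE m n k =
  Σ (VSet m n) (λ A → MinimalPercolating A × size A ≡ k) ×
  (∀ (A : VSet m n) → MinimalPercolating A → size A ≤ k)

{-# OPTIONS --safe #-}
module Submission where

-- Upper bound: every percolating set contains a percolating list of at most 2(m+n)/3 vertices,
-- and a minimal percolating set equals that list. The rectangles process shows that the occupied
-- columns of a percolating set form a chain without two consecutive gaps, and that some core
-- spans a block of full height. Once such a block exists, one vertex in about two of every three
-- further columns suffices; so the work lies in finding a core that is cheap for its width (two
-- opposite vertices, three rows met in two or three consecutive columns, or blocks of two rows
-- that meet a third row or each other).
-- Lower bound: a short prefix followed by the columns ∅ , r , r repeated. Each vertex is needed,
-- since without it a first column, two consecutive columns, an outer row or the unique pair of
-- nearby vertices in different rows would be lost.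

open import Defs
open import Data.Bool using (Bool; true; false; _∧_; if_then_else_)
open import Data.Bool.Properties using () renaming (_≟_ to _≟ᴮ_)
open import Data.Empty using (⊥; ⊥-elim)
open import Data.Fin as Fin using (Fin; zero; suc; toℕ; fromℕ<)
open import Data.Fin.Properties using (toℕ-injective; toℕ<n; toℕ-fromℕ<; any?)
open import Data.List using (List; []; _∷_; _++_; length; map; allFin)
open import Data.List.Membership.Propositional using (_∈_)
open import Data.List.Membership.Propositional.Properties using (∈-map⁺; ∈-++⁺ˡ; ∈-++⁺ʳ)
import Data.List.Membership.DecPropositional as DecMembership
open import Data.List.Properties using (length-map; length-++; map-tabulate)
open import Data.List.Relation.Unary.All as All using (All; []; _∷_)
open import Data.List.Relation.Unary.All.Properties as All using ()
open import Data.List.Relation.Unary.Any using (here; there)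
open import Data.Nat
open import Data.Nat.Divisibility using (n∣m*n)
open import Data.Nat.DivMod using (_/_; m*n/n≡m; /-monoˡ-≤; +-distrib-/-∣ʳ; m<n⇒m/n≡0)
open import Data.Nat.ListAction using (sum)
open import Data.Nat.Properties
open import Data.Nat.Tactic.RingSolver using (solve-∀)
open import Data.Product using (Σ; ∃; _×_; _,_; proj₁; proj₂; uncurry)
open import Data.Product.Properties using (≡-dec)
open import Data.Sum using (_⊎_; inj₁; inj₂; [_,_]′; fromInj₁; fromInj₂)
open import Function using (_∘_; id)
open import Relation.Binary.Definitions using (DecidableEquality; tri<; tri≈; tri>)
open import Relation.Binary.PropositionalEquality
open import Relation.Nullary using (¬_; Dec; yes; no; contradiction; does)
open import Relation.Nullary.Decidable using (map′; _⊎-dec_; _×-dec_; toSum; dec-true; dec-false)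

data Side : Set where
  top bot : Side

opp : Side → Side
opp top = bot
opp bot = top

opp-involutive : ∀ s → opp (opp s) ≡ s
opp-involutive top = refl
opp-involutive bot = refl

same-or-opp : ∀ s s' → s' ≡ s ⊎ s' ≡ opp s
same-or-opp top top = inj₁ refl
same-or-opp top bot = inj₂ refl
same-or-opp bot top = inj₂ refl
same-or-opp bot bot = inj₁ refl

data Row : Set where
  mid : Row
  out : Side → Row

data _~_ : Row → Row → Set where
  out~mid : ∀ {s} → out s ~ mid
  mid~out : ∀ {s} → mid ~ out s

~-sym : ∀ {y y'} → y ~ y' → y' ~ y
~-sym out~mid = mid~out
~-sym mid~out = out~mid

data Kind : Set where
  one : Row → Kind
  two : Side → Kind
  all : Kind

data _∈ᴷ_ : Row → Kind → Set where
  single : ∀ {y} → y ∈ᴷ one y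
  outer  : ∀ {s} → out s ∈ᴷ two s
  middle : ∀ {s} → mid ∈ᴷ two s
  any    : ∀ {y} → y ∈ᴷ all

∈ᴷ-convex : ∀ {K} s → out s ∈ᴷ K → out (opp s) ∈ᴷ K → mid ∈ᴷ K
∈ᴷ-convex top single ()
∈ᴷ-convex top outer ()
∈ᴷ-convex bot single ()
∈ᴷ-convex bot outer ()
∈ᴷ-convex s any q = any

Config : Set₁
Config = ℕ → Row → Set

-- Infection never leaves the bounding box of S, so the columns need no upper limit.
data Cl (S : Config) : Config where
  base    : ∀ {x y} → S x y → Cl S x y
  across  : ∀ {x y} → Cl S x y → Cl S (2 + x) y → Cl S (1 + x) y
  between : ∀ {x} s → Cl S x (out s) → Cl S x (out (opp s)) → Cl S x mid
  cornerˡ : ∀ {x y y'} → y ~ y' → Cl S x y → Cl S (1 + x) y' → Cl S x y'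
  cornerʳ : ∀ {x y y'} → y ~ y' → Cl S x y → Cl S (1 + x) y' → Cl S (1 + x) y

Cl-mono : ∀ {S S' : Config} → (∀ {x y} → S x y → S' x y) → ∀ {x y} → Cl S x y → Cl S' x y
Cl-mono f (base p) = base (f p)
Cl-mono f (across p q) = across (Cl-mono f p) (Cl-mono f q)
Cl-mono f (between s p q) = between s (Cl-mono f p) (Cl-mono f q)
Cl-mono f (cornerˡ e p q) = cornerˡ e (Cl-mono f p) (Cl-mono f q)
Cl-mono f (cornerʳ e p q) = cornerʳ e (Cl-mono f p) (Cl-mono f q)

Cl-bounded : ∀ {S M} → (∀ {x y} → S x y → x ≤ M) → ∀ {x y} → Cl S x y → x ≤ M
Cl-bounded bd (base p) = bd p
Cl-bounded bd (across p q) = ≤-trans (n≤1+n _) (Cl-bounded bd q)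
Cl-bounded bd (between s p q) = Cl-bounded bd p
Cl-bounded bd (cornerˡ e p q) = Cl-bounded bd p
Cl-bounded bd (cornerʳ e p q) = Cl-bounded bd q

spread : ∀ {K} (Z : Row → Set) → (∀ {y y'} → y ~ y' → y' ∈ᴷ K → Z y → Z y') →
         ∀ {y₀ y} → y₀ ∈ᴷ K → Z y₀ → y ∈ᴷ K → Z y
spread Z f {mid} {mid} p z q = z
spread Z f {mid} {out s} p z q = f mid~out q z
spread Z f {out s} {mid} p z q = f out~mid q z
spread Z f {out s} {out s'} p z q with same-or-opp s s'
... | inj₁ refl = z
... | inj₂ refl = f mid~out q (f out~mid (∈ᴷ-convex s p q) z)

fillʳ : ∀ {S K x y₀} → (∀ {y} → y ∈ᴷ K → Cl S x y) → y₀ ∈ᴷ K → Cl S (1 + x) y₀ →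
        ∀ {y} → y ∈ᴷ K → Cl S (1 + x) y
fillʳ {S} full p z q = spread (Cl S _) (λ e q z → cornerʳ (~-sym e) (full q) z) p z q

fillˡ : ∀ {S K x y₀} → (∀ {y} → y ∈ᴷ K → Cl S (1 + x) y) → y₀ ∈ᴷ K → Cl S x y₀ →
        ∀ {y} → y ∈ᴷ K → Cl S x y
fillˡ {S} full p z q = spread (Cl S _) (λ e q z → cornerˡ e z (full q)) p z q

every-row : ∀ {Z : Row → Set} s → Z mid → Z (out s) → Z (out (opp s)) → ∀ y → Z y
every-row s m o o' mid = m
every-row s m o o' (out s') with same-or-opp s s'
... | inj₁ refl = o
... | inj₂ refl = o'

N : Config → Kind → ℕ → Set
N A K x = ∃ λ y → y ∈ᴷ K × A x y

Decidable : Config → Set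
Decidable A = ∀ x y → Dec (A x y)

N? : ∀ {A} → Decidable A → ∀ K x → Dec (N A K x)
N? A? (one y) x = map′ (λ p → y , single , p) (λ { (_ , single , p) → p }) (A? x y)
N? A? (two s) x = map′
  [ (λ p → mid , middle , p) , (λ p → out s , outer , p) ]′
  (λ { (_ , outer , p) → inj₂ p ; (_ , middle , p) → inj₁ p })
  (A? x mid ⊎-dec A? x (out s))
N? A? all x = map′
  [ (λ p → mid , any , p) , [ (λ p → out top , any , p) , (λ p → out bot , any , p) ]′ ]′
  (λ { (mid , any , p) → inj₁ p ; (out top , any , p) → inj₂ (inj₁ p) ; (out bot , any , p) → inj₂ (inj₂ p) })
  (A? x mid ⊎-dec (A? x (out top) ⊎-dec A? x (out bot)))

record Chain (P : ℕ → Set) (a b : ℕ) : Set where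
  field
    ordered : a ≤ b
    first   : P a
    last    : P b
    gapless : ∀ {x} → a ≤ x → x < b → P x ⊎ P (suc x)
open Chain

Chain-map : ∀ {P Q : ℕ → Set} {a b} → (∀ {x} → P x → Q x) → Chain P a b → Chain Q a b
Chain-map f ch = record
  { ordered = ordered ch ; first = f (first ch) ; last = f (last ch)
  ; gapless = λ a≤x x<b → [ inj₁ ∘ f , inj₂ ∘ f ]′ (gapless ch a≤x x<b) }

subchain : ∀ {P a b a' b'} → Chain P a b → a ≤ a' → a' ≤ b' → b' ≤ b → P a' → P b' → Chain P a' b'
subchain ch a≤a' a'≤b' b'≤b p q = record
  { ordered = a'≤b' ; first = p ; last = q
  ; gapless = λ a'≤x x<b' → gapless ch (≤-trans a≤a' a'≤x) (≤-trans x<b' b'≤b) }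

Chain-point : ∀ {P a} → P a → Chain P a a
Chain-point p = record
  { ordered = ≤-refl ; first = p ; last = p ; gapless = λ a≤x x<a → contradiction x<a (≤⇒≯ a≤x) }

Chain-++ : ∀ {P a b c d} → a ≤ c → c ≤ 2 + b → b ≤ d → Chain P a b → Chain P c d → Chain P a d
Chain-++ {P} {a} {b} {c} {d} a≤c c≤2+b b≤d ch ch' = record
  { ordered = ≤-trans (ordered ch) b≤d ; first = first ch ; last = last ch' ; gapless = gap }
  where
  gap : ∀ {x} → a ≤ x → x < d → P x ⊎ P (suc x)
  gap {x} a≤x x<d with x <? b | c ≤? x
  ... | yes x<b | _ = gapless ch a≤x x<b
  ... | no _ | yes c≤x = gapless ch' c≤x x<d
  ... | no x≮b | no c≰x with m≤n⇒m<n∨m≡n (≮⇒≥ x≮b)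
  ... | inj₂ refl = inj₁ (last ch)
  ... | inj₁ b<x = inj₂ (subst P (≤-antisym (≤-trans c≤2+b (s≤s b<x)) (≰⇒> c≰x)) (first ch'))

Vertices : Set
Vertices = List (ℕ × Row)

⟦_⟧ : Vertices → Config
⟦ L ⟧ x y = (x , y) ∈ L

-- t bounds three times the number of vertices, which keeps the bounds 2(m+n)/3 integral.
record Span (A : Config) (K : Kind) (a b t : ℕ) : Set where
  field
    verts  : Vertices
    inside : All (uncurry A) verts
    a≤b    : a ≤ b
    spans  : ∀ {x y} → a ≤ x → x ≤ b → y ∈ᴷ K → Cl ⟦ verts ⟧ x y
    cost   : 3 * length verts ≤ t
open Span

relax : ∀ {A K a b t t'} → t ≤ t' → Span A K a b t → Span A K a b t'
relax le sp = record
  { verts = verts sp ; inside = inside sp ; a≤b = a≤b sp ; spans = spans sp ; cost = ≤-trans (cost sp) le }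

module _ {A : Config} {K : Kind} {a b t : ℕ} (sp : Span A K a b t) where

  private
    cost-∷ : ∀ (L : Vertices) → 3 * length L ≤ t → 3 * suc (length L) ≤ 3 + t
    cost-∷ L le = ≤-trans (≤-reflexive (*-suc 3 (length L))) (+-monoʳ-≤ 3 le)

  take₁ : N A K (1 + b) → Span A K a (1 + b) (3 + t)
  take₁ (y₀ , y₀∈K , p) = record
    { verts = L ; inside = p ∷ inside sp ; a≤b = m≤n⇒m≤1+n (a≤b sp)
    ; spans = spans' ; cost = cost-∷ (verts sp) (cost sp) }
    where
    L = (1 + b , y₀) ∷ verts sp
    spans' : ∀ {x y} → a ≤ x → x ≤ 1 + b → y ∈ᴷ K → Cl ⟦ L ⟧ x y
    spans' a≤x x≤1+b y∈K with m≤n⇒m<n∨m≡n x≤1+b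
    ... | inj₁ (s≤s x≤b) = Cl-mono there (spans sp a≤x x≤b y∈K)
    ... | inj₂ refl = fillʳ (Cl-mono there ∘ spans sp (a≤b sp) ≤-refl) y₀∈K (base (here refl)) y∈K

  take₂ : N A K (2 + b) → Span A K a (2 + b) (3 + t)
  take₂ (y₀ , y₀∈K , p) = record
    { verts = L ; inside = p ∷ inside sp ; a≤b = m≤n⇒m≤1+n (m≤n⇒m≤1+n (a≤b sp))
    ; spans = spans' ; cost = cost-∷ (verts sp) (cost sp) }
    where
    L = (2 + b , y₀) ∷ verts sp
    new : Cl ⟦ L ⟧ (2 + b) y₀
    new = base (here refl)
    old : ∀ {y} → y ∈ᴷ K → Cl ⟦ L ⟧ b y
    old = Cl-mono there ∘ spans sp (a≤b sp) ≤-refl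
    next : ∀ {y} → y ∈ᴷ K → Cl ⟦ L ⟧ (1 + b) y
    next = fillʳ old y₀∈K (across (old y₀∈K) new)
    spans' : ∀ {x y} → a ≤ x → x ≤ 2 + b → y ∈ᴷ K → Cl ⟦ L ⟧ x y
    spans' a≤x x≤2+b y∈K with m≤n⇒m<n∨m≡n x≤2+b
    ... | inj₂ refl = fillʳ next y₀∈K new y∈K
    ... | inj₁ (s≤s x≤1+b) with m≤n⇒m<n∨m≡n x≤1+b
    ... | inj₂ refl = next y∈K
    ... | inj₁ (s≤s x≤b) = Cl-mono there (spans sp a≤x x≤b y∈K)

private
  ≡₁ : ∀ t r → 3 + t + 2 * suc r ≡ t + suc (2 * (2 + r))
  ≡₁ = solve-∀
  ≡₂ : ∀ t r → 3 + t + suc (2 * r) ≡ t + 2 * (2 + r)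
  ≡₂ = solve-∀
  shift₁ : ∀ {b} r q → suc r + q ≡ b → r + suc q ≡ b
  shift₁ r q eq = trans (+-suc r q) eq
  shift₂ : ∀ {b} r q → 2 + r + q ≡ b → r + (2 + q) ≡ b
  shift₂ r q eq = trans (+-suc r (suc q)) (trans (cong suc (+-suc r q)) eq)

gapless-at : ∀ {P c q b} r → 2 + r + q ≡ b → c ≤ q → Chain P c b → P (1 + q) ⊎ P (2 + q)
gapless-at {q = q} r eq c≤q ch =
  gapless ch (m≤n⇒m≤1+n c≤q) (subst (2 + q ≤_) eq (s≤s (s≤s (m≤n+m q r))))

-- Of two consecutive occupied columns only the second is used, so on average
-- 2/3 of a vertex is spent per column, up to a boundary term.
mutual
  extend : ∀ {A K a c q b t} → Decidable A → ∀ r → r + q ≡ b → c ≤ q → Chain (N A K) c b →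
           Span A K a q t → Span A K a b (t + suc (2 * r))
  extend A? zero refl c≤q ch sp = relax (m≤m+n _ 1) sp
  extend {t = t} A? (suc zero) refl c≤q ch sp = relax (≤-reflexive (+-comm 3 t)) (take₁ sp (last ch))
  extend {K = K} {q = q} {t = t} A? (suc (suc r)) eq c≤q ch sp =
    [ (λ n₂ → relax (≤-trans (≤-reflexive (≡₂ t r)) (+-monoʳ-≤ t (n≤1+n _)))
        (extend A? r (shift₂ r q eq) (m≤n⇒m≤1+n (m≤n⇒m≤1+n c≤q)) ch (take₂ sp n₂)))
    , (λ ¬n₂ → relax (≤-reflexive (≡₁ t r))
        (extend₀ A? (suc r) (shift₁ (suc r) q eq) (m≤n⇒m≤1+n c≤q) ch ¬n₂
          (take₁ sp (fromInj₁ (λ n₂ → contradiction n₂ ¬n₂) (gapless-at r eq c≤q ch))))) ]′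
    (toSum (N? A? K (2 + q)))

  extend₀ : ∀ {A K a c q b t} → Decidable A → ∀ r → r + q ≡ b → c ≤ q → Chain (N A K) c b →
            ¬ N A K (1 + q) → Span A K a q t → Span A K a b (t + 2 * r)
  extend₀ A? zero refl c≤q ch ¬n₁ sp = relax (m≤m+n _ 0) sp
  extend₀ A? (suc zero) refl c≤q ch ¬n₁ sp = contradiction (last ch) ¬n₁
  extend₀ {q = q} {t = t} A? (suc (suc r)) eq c≤q ch ¬n₁ sp =
    relax (≤-reflexive (≡₂ t r))
      (extend A? r (shift₂ r q eq) (m≤n⇒m≤1+n (m≤n⇒m≤1+n c≤q)) ch
        (take₂ sp (fromInj₂ (λ n₁ → contradiction n₁ ¬n₁) (gapless-at r eq c≤q ch))))

-- Reflection of the columns 0 … M.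

reflect : ℕ → Config → Config
reflect M A x y = ∃ λ x' → x' + x ≡ M × A x' y

reflect-dec : ∀ {A} M → Decidable A → Decidable (reflect M A)
reflect-dec {A} M A? x y with x ≤? M
... | no x≰M = no λ { (x' , eq , _) → x≰M (subst (x ≤_) eq (m≤n+m x x')) }
... | yes x≤M = map′
  (λ p → M ∸ x , m∸n+n≡m x≤M , p)
  (λ { (x' , eq , p) → subst (λ z → A z y) (+-cancelʳ-≡ x x' _ (trans eq (sym (m∸n+n≡m x≤M)))) p })
  (A? (M ∸ x) y)

complement-≤ : ∀ {M x x' a a'} → x' + x ≡ M → a' + a ≡ M → x' ≤ a' → a ≤ x
complement-≤ {x = x} {x'} {a} {a'} ex ea x'≤a' =
  ≮⇒≥ λ x<a → <-irrefl (trans ex (sym ea)) (+-mono-≤-< x'≤a' x<a)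

complement-≡ : ∀ {M x x' x''} → x' + x ≡ M → x'' + x ≡ M → x'' ≡ x'
complement-≡ {x = x} {x'} {x''} e e' = +-cancelʳ-≡ x x'' x' (trans e' (sym e))

swap-+ : ∀ {M} x x' → x' + x ≡ M → x + x' ≡ M
swap-+ x x' eq = trans (+-comm x x') eq

Cl-reflect : ∀ {S S' : Config} {M} → (∀ {x y} → S x y → x ≤ M) →
             (∀ {x x' y} → x' + x ≡ M → S x y → S' x' y) →
             ∀ {x x' y} → x' + x ≡ M → Cl S x y → Cl S' x' y
Cl-reflect bd f eq (base p) = base (f eq p)
Cl-reflect {M = M} bd f {suc x} {zero} eq (across p q) =
  contradiction (Cl-bounded bd q) (<⇒≱ (s≤s (≤-reflexive (sym eq))))
Cl-reflect bd f {suc x} {suc x'} eq (across p q) =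
  across (Cl-reflect bd f (trans (+-suc x' (suc x)) eq) q)
         (Cl-reflect bd f (trans (cong suc (sym (+-suc x' x))) eq) p)
Cl-reflect bd f eq (between s p q) = between s (Cl-reflect bd f eq p) (Cl-reflect bd f eq q)
Cl-reflect bd f {x} {zero} eq (cornerˡ e p q) =
  contradiction (Cl-bounded bd q) (<⇒≱ (s≤s (≤-reflexive (sym eq))))
Cl-reflect bd f {x} {suc x'} eq (cornerˡ e p q) =
  cornerʳ (~-sym e) (Cl-reflect bd f (trans (+-suc x' x) eq) q) (Cl-reflect bd f eq p)
Cl-reflect bd f {suc x} {x'} eq (cornerʳ e p q) =
  cornerˡ (~-sym e) (Cl-reflect bd f eq q) (Cl-reflect bd f (trans (sym (+-suc x' x)) eq) p)

module _ {A A' : Config} {M : ℕ} (bounded : ∀ {x y} → A x y → x ≤ M)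
         (f : ∀ {x x' y} → x' + x ≡ M → A x y → A' x' y) where

  Span-transfer : ∀ {K a b a' b' t} → a' + a ≡ M → b' + b ≡ M → Span A K a b t → Span A' K b' a' t
  Span-transfer {K} {a} {b} {a'} {b'} ea eb sp = record
    { verts  = map ρ (verts sp)
    ; inside = All.map⁺ (All.map (λ p → f (m∸n+n≡m (bounded p)) p) (inside sp))
    ; a≤b    = complement-≤ (swap-+ a a' ea) (swap-+ b b' eb) (a≤b sp)
    ; spans  = spans'
    ; cost   = subst (λ l → 3 * l ≤ _) (sym (length-map ρ (verts sp))) (cost sp) }
    where
    ρ : ℕ × Row → ℕ × Row
    ρ (x , y) = M ∸ x , y
    ∈-ρ : ∀ {x x' y} → x' + x ≡ M → ⟦ verts sp ⟧ x y → ⟦ map ρ (verts sp) ⟧ x' y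
    ∈-ρ {x} {x'} {y} eq p =
      subst (λ z → (z , y) ∈ map ρ (verts sp))
            (complement-≡ eq (m∸n+n≡m (bounded (All.lookup (inside sp) p)))) (∈-map⁺ ρ p)
    spans' : ∀ {x' y} → b' ≤ x' → x' ≤ a' → y ∈ᴷ K → Cl ⟦ map ρ (verts sp) ⟧ x' y
    spans' {x'} b'≤x' x'≤a' y∈K =
      Cl-reflect (bounded ∘ All.lookup (inside sp)) ∈-ρ (swap-+ x' _ ex)
        (spans sp (complement-≤ (swap-+ x' _ ex) ea x'≤a')
                  (complement-≤ eb (swap-+ x' _ ex) b'≤x') y∈K)
      where
      ex : (M ∸ x') + x' ≡ M
      ex = m∸n+n≡m (≤-trans x'≤a' (subst (a' ≤_) ea (m≤m+n a' a)))

module _ {A : Config} {M : ℕ} (bounded : ∀ {x y} → A x y → x ≤ M) where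

  Span-reflect : ∀ {K a b a' b' t} → a' + a ≡ M → b' + b ≡ M → Span A K a b t → Span (reflect M A) K b' a' t
  Span-reflect = Span-transfer bounded (λ {x} {x'} eq p → x , swap-+ x x' eq , p)

  Span-unreflect : ∀ {K a b a' b' t} → a' + a ≡ M → b' + b ≡ M → Span (reflect M A) K a b t → Span A K b' a' t
  Span-unreflect = Span-transfer
    (λ { {x} (x' , eq , p) → subst (x ≤_) eq (m≤n+m x x') })
    (λ { {y = y} eq (x'' , eq' , p) → subst (λ z → A z y) (complement-≡ eq eq') p })

N-reflect : ∀ {A M K x x'} → x' + x ≡ M → N A K x → N (reflect M A) K x'
N-reflect {x = x} {x'} eq (y , y∈K , p) = y , y∈K , x , swap-+ x x' eq , p

N-unreflect : ∀ {A M K x x'} → x' + x ≡ M → N (reflect M A) K x' → N A K x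
N-unreflect {A} {x = x} {x'} eq (y , y∈K , x'' , eq' , p) =
  y , y∈K , subst (λ z → A z y) (complement-≡ (swap-+ x x' eq) eq') p

Chain-reflect : ∀ {A M K a b a' b'} → a' + a ≡ M → b' + b ≡ M →
                Chain (N A K) a b → Chain (N (reflect M A) K) b' a'
Chain-reflect {A} {M} {K} {a} {b} {a'} {b'} ea eb ch = record
  { ordered = complement-≤ (swap-+ a a' ea) (swap-+ b b' eb) (ordered ch)
  ; first = N-reflect eb (last ch) ; last = N-reflect ea (first ch) ; gapless = gap }
  where
  gap : ∀ {x} → b' ≤ x → x < a' → N (reflect M A) K x ⊎ N (reflect M A) K (suc x)
  gap {x} b'≤x x<a' =
    [ inj₂ ∘ N-reflect ex' , inj₁ ∘ N-reflect ex ]′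
      (gapless ch (complement-≤ ex' ea x<a') (complement-≤ eb ex b'≤x))
    where
    z = M ∸ suc x
    ex' : suc x + z ≡ M
    ex' = m+[n∸m]≡n (≤-trans x<a' (subst (a' ≤_) ea (m≤m+n a' a)))
    ex : x + suc z ≡ M
    ex = trans (+-suc x z) ex'

LeftEmpty : Config → Kind → ℕ → Set
LeftEmpty A K a = ∀ {x} → suc x ≡ a → ¬ N A K x

-- The price of extending past an end of a block (see extend, extend₀).
data Toll (E : Set) : ℕ → Set where
  free : E → Toll E 0
  paid : Toll E 1

extendʳ : ∀ {A K a c q b t τ} → Decidable A → ∀ r → r + q ≡ b → c ≤ q → Chain (N A K) c b →
          Toll (¬ N A K (suc q)) τ → Span A K a q t → Span A K a b (t + (τ + 2 * r))
extendʳ A? r eq c≤q ch (free e) sp = extend₀ A? r eq c≤q ch e sp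
extendʳ A? r eq c≤q ch paid sp = extend A? r eq c≤q ch sp

extendˡ : ∀ {A M K a b q d t τ} → Decidable A → (∀ {x y} → A x y → x ≤ M) → ∀ r → r + a ≡ q → q ≤ d →
          Chain (N A K) a d → Toll (LeftEmpty A K q) τ → b ≤ M →
          Span A K q b t → Span A K a b (t + (τ + 2 * r))
extendˡ {A} {M} {K} {a} {b} {q} {d} A? bounded r refl q≤d ch toll b≤M sp =
  Span-unreflect bounded (m+[n∸m]≡n b≤M) ea
    (extendʳ {q = q'} (reflect-dec M A?) r eq'' (complement-≤ {a' = d} (swap-+ q q' eq') (m+[n∸m]≡n d≤M) q≤d)
      (Chain-reflect (m∸n+n≡m a≤M) (m∸n+n≡m d≤M) ch) (toll' toll)
      (Span-reflect bounded eq' (m∸n+n≡m b≤M) sp))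
  where
  q' = M ∸ q
  a' = M ∸ a
  d≤M : d ≤ M
  d≤M = bounded (proj₂ (proj₂ (last ch)))
  a≤M : a ≤ M
  a≤M = bounded (proj₂ (proj₂ (first ch)))
  eq' : q' + q ≡ M
  eq' = m∸n+n≡m (≤-trans q≤d d≤M)
  ea : a + a' ≡ M
  ea = m+[n∸m]≡n a≤M
  eq'' : r + q' ≡ a'
  eq'' = +-cancelˡ-≡ a (r + q') a' (trans (trans (sym (+-assoc a r q')) (trans (cong (_+ q') (+-comm a r)) (swap-+ (r + a) q' eq'))) (sym ea))
  toll' : ∀ {τ} → Toll (LeftEmpty A K q) τ → Toll (¬ N (reflect M A) K (suc q')) τ
  toll' paid = paid
  toll' (free le) = free λ { n@(_ , _ , x , ex , _) →
    le (+-cancelˡ-≡ q' (suc x) q (trans (trans (+-suc q' x) (trans (cong suc (+-comm q' x)) (trans (sym (+-suc x q')) ex))) (sym eq')))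
       (N-unreflect {x = x} (swap-+ (suc q') x ex) n) }
-- Blocks of two rows.

data Seed (A : Config) (s : Side) : ℕ → ℕ → Set where
  flat : ∀ {p} → A p (out s) → A p mid → Seed A s p p
  up   : ∀ {p} → A p (out s) → A (1 + p) mid → Seed A s p (1 + p)
  down : ∀ {p} → A p mid → A (1 + p) (out s) → Seed A s p (1 + p)

Seed-ordered : ∀ {A s p q} → Seed A s p q → p ≤ q
Seed-ordered (flat _ _) = ≤-refl
Seed-ordered (up _ _) = n≤1+n _
Seed-ordered (down _ _) = n≤1+n _

Seed-first : ∀ {A s p q} → Seed A s p q → N A (two s) p
Seed-first (flat o m) = _ , middle , m
Seed-first (up o m) = _ , outer , o
Seed-first (down m o) = _ , middle , m

Seed-last : ∀ {A s p q} → Seed A s p q → N A (two s) q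
Seed-last (flat o m) = _ , middle , m
Seed-last (up o m) = _ , middle , m
Seed-last (down m o) = _ , outer , o

Seed-outer : ∀ {A s p q} → Seed A s p q → ∃ λ x → p ≤ x × x ≤ q × A x (out s)
Seed-outer (flat o m) = _ , ≤-refl , ≤-refl , o
Seed-outer (up o m) = _ , ≤-refl , n≤1+n _ , o
Seed-outer (down m o) = _ , n≤1+n _ , ≤-refl , o

reflect-∋ : ∀ (A : Config) {M x x' y} → x' + x ≡ M → A x y → reflect M A x' y
reflect-∋ A {x = x} {x'} eq p = x , swap-+ x x' eq , p

Seed-reflect : ∀ {A M s p q p' q'} → p' + p ≡ M → q' + q ≡ M → Seed A s p q → Seed (reflect M A) s q' p'
Seed-reflect {A} {p' = p'} {q'} ep eq (flat {p} o m) with complement-≡ {x = p} {p'} {q'} ep eq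
... | refl = flat (reflect-∋ A ep o) (reflect-∋ A ep m)
Seed-reflect {A} {p' = p'} {q'} ep eq (up {p} o m)
  with complement-≡ {x = p} {p'} {suc q'} ep (trans (sym (+-suc q' p)) eq)
... | refl = down (reflect-∋ A eq m) (reflect-∋ A ep o)
Seed-reflect {A} {p' = p'} {q'} ep eq (down {p} m o)
  with complement-≡ {x = p} {p'} {suc q'} ep (trans (sym (+-suc q' p)) eq)
... | refl = up (reflect-∋ A eq o) (reflect-∋ A ep m)

≤-one : ∀ {a x} → a ≤ x → x ≤ 1 + a → x ≡ a ⊎ x ≡ 1 + a
≤-one a≤x x≤1+a with m≤n⇒m<n∨m≡n x≤1+a
... | inj₂ eq = inj₂ eq
... | inj₁ (s≤s x≤a) = inj₁ (≤-antisym x≤a a≤x)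

module _ {A : Config} {s : Side} where

  flat-span : ∀ {p} → A p (out s) → A p mid → Span A (two s) p p 6
  flat-span {p} o m = record
    { verts = (p , out s) ∷ (p , mid) ∷ [] ; inside = o ∷ m ∷ [] ; a≤b = ≤-refl ; cost = ≤-refl
    ; spans = λ a≤x x≤a → spans' (≤-antisym x≤a a≤x) }
    where
    spans' : ∀ {x y} → x ≡ p → y ∈ᴷ two s → Cl ⟦ (p , out s) ∷ (p , mid) ∷ [] ⟧ x y
    spans' refl outer = base (here refl)
    spans' refl middle = base (there (here refl))

  diagonal-span : ∀ {p y y'} → y ~ y' → y ∈ᴷ two s → y' ∈ᴷ two s → A p y → A (1 + p) y' →
                  Span A (two s) p (1 + p) 6
  diagonal-span {p} {y} {y'} e i i' a a' = record
    { verts = (p , y) ∷ (1 + p , y') ∷ [] ; inside = a ∷ a' ∷ [] ; a≤b = n≤1+n p ; cost = ≤-refl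
    ; spans = λ p≤x x≤1+p → spans' e i i' (≤-one p≤x x≤1+p) }
    where
    S = ⟦ (p , y) ∷ (1 + p , y') ∷ [] ⟧
    c : Cl S p y
    c = base (here refl)
    c' : Cl S (1 + p) y'
    c' = base (there (here refl))
    spans' : ∀ {x z} → y ~ y' → y ∈ᴷ two s → y' ∈ᴷ two s → x ≡ p ⊎ x ≡ 1 + p → z ∈ᴷ two s → Cl S x z
    spans' out~mid outer middle (inj₁ refl) outer = c
    spans' out~mid outer middle (inj₁ refl) middle = cornerˡ e c c'
    spans' out~mid outer middle (inj₂ refl) outer = cornerʳ e c c'
    spans' out~mid outer middle (inj₂ refl) middle = c'
    spans' mid~out middle outer (inj₁ refl) outer = cornerˡ e c c'
    spans' mid~out middle outer (inj₁ refl) middle = c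
    spans' mid~out middle outer (inj₂ refl) outer = c'
    spans' mid~out middle outer (inj₂ refl) middle = cornerʳ e c c'

-- A two-row block from a seed to the column b. Unless its first column is flat with an
-- empty column to its left, it satisfies the bound with one unit to spare.
record Arm (A : Config) (s : Side) (b : ℕ) : Set where
  field
    {start width price toll} : ℕ
    block  : Span A (two s) start b price
    extent : width + start ≡ b
    left   : Toll (LeftEmpty A (two s) start × A start (out s) × A start mid) toll
    bound  : price + toll ≤ 2 * width + 6

left-empty? : ∀ {A} → Decidable A → ∀ K p → LeftEmpty A K p ⊎ ∃ λ x → suc x ≡ p × N A K x
left-empty? A? K zero = inj₁ λ ()
left-empty? A? K (suc x) with N? A? K x
... | yes n = inj₂ (x , refl , n)
... | no ¬n = inj₁ λ { refl → ¬n }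

module _ {A : Config} (A? : Decidable A) {s : Side} {a b : ℕ} (ch : Chain (N A (two s)) a b) where

  private
    diagonal-arm : ∀ {p} → a ≤ 1 + p → 1 + p ≤ b → Span A (two s) p (1 + p) 6 → Arm A s b
    diagonal-arm {p} a≤q q≤b sp = record
      { block = extend A? r eq a≤q ch sp ; extent = trans (sym (+-suc r p)) eq
      ; left = paid ; bound = ≤-reflexive (arith r) }
      where
      r = b ∸ (1 + p)
      eq : r + (1 + p) ≡ b
      eq = m∸n+n≡m q≤b
      arith : ∀ r → 6 + suc (2 * r) + 1 ≡ 2 * suc r + 6
      arith = solve-∀

  arm : ∀ {p q} → a ≤ p → Seed A s p q → q ≤ b → Arm A s b
  arm a≤p (up o m) q≤b = diagonal-arm (m≤n⇒m≤1+n a≤p) q≤b (diagonal-span out~mid outer middle o m)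
  arm a≤p (down m o) q≤b = diagonal-arm (m≤n⇒m≤1+n a≤p) q≤b (diagonal-span mid~out middle outer m o)
  arm {p} a≤p (flat o m) p≤b with left-empty? A? (two s) p
  ... | inj₂ (x , refl , _ , outer , o') = diagonal-arm a≤p p≤b (diagonal-span out~mid outer middle o' m)
  ... | inj₂ (x , refl , _ , middle , m') = diagonal-arm a≤p p≤b (diagonal-span mid~out middle outer m' o)
  ... | inj₁ le with m≤n⇒m<n∨m≡n p≤b
  ...   | inj₂ refl = record
    { block = flat-span o m ; extent = refl ; left = free (le , o , m) ; bound = ≤-refl }
  ...   | inj₁ p<b with N? A? (two s) (1 + p)
  ...     | yes (_ , outer , o') = diagonal-arm (m≤n⇒m≤1+n a≤p) p<b (diagonal-span mid~out middle outer m o')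
  ...     | yes (_ , middle , m') = diagonal-arm (m≤n⇒m≤1+n a≤p) p<b (diagonal-span out~mid outer middle o m')
  ...     | no ¬n = record
    { block = extend₀ A? (b ∸ p) (m∸n+n≡m p≤b) a≤p ch ¬n (flat-span o m)
    ; extent = m∸n+n≡m p≤b ; left = free (le , o , m) ; bound = ≤-reflexive (arith (b ∸ p)) }
    where
    arith : ∀ r → 6 + 2 * r + 0 ≡ 2 * r + 6
    arith = solve-∀

-- Percolating sets in three rows.

record Setup (A : Config) (M : ℕ) : Set where
  field
    A?      : Decidable A
    bounded : ∀ {x y} → A x y → x ≤ M
    linked  : Chain (N A all) 0 M
open Setup

reflect-bounded : ∀ (A : Config) {M x y} → reflect M A x y → x ≤ M
reflect-bounded A {x = x} (x' , eq , _) = subst (x ≤_) eq (m≤n+m x x')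

reflect-Setup : ∀ {A M} → Setup A M → Setup (reflect M A) M
reflect-Setup {A} {M} S = record
  { A? = reflect-dec M (A? S) ; bounded = reflect-bounded A
  ; linked = Chain-reflect (+-identityʳ M) refl (linked S) }

Result : Config → ℕ → Set
Result A M = Span A all 0 M (2 * M + 8)

Result-unreflect : ∀ {A M} → Setup A M → Result (reflect M A) M → Result A M
Result-unreflect {M = M} S = Span-unreflect (bounded S) (+-identityʳ M) refl

complete : ∀ {A M a b t w τ τ'} → Setup A M → w + a ≡ b → b ≤ M →
           Toll (LeftEmpty A all a) τ → Toll (¬ N A all (suc b)) τ' →
           Span A all a b t → t + (τ + τ') ≤ 2 * w + 8 → Result A M
complete {a = a} {t = t} {w} {τ} {τ'} S refl b≤M left right sp le with m≤n⇒∃[o]m+o≡n b≤M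
... | r , refl = relax (≤-trans (≤-reflexive (arith₁ t τ τ' a r)) (≤-trans (+-monoˡ-≤ _ le) (≤-reflexive (arith₂ w a r))))
  (extendˡ (A? S) (bounded S) a (+-identityʳ a) (≤-trans (m≤n+m a w) b≤M) (linked S) left ≤-refl
    (extendʳ (A? S) r (+-comm r (w + a)) z≤n (linked S) right sp))
  where
  arith₁ : ∀ t τ τ' a r → t + (τ' + 2 * r) + (τ + 2 * a) ≡ t + (τ + τ') + (2 * r + 2 * a)
  arith₁ = solve-∀
  arith₂ : ∀ w a r → 2 * w + 8 + (2 * r + 2 * a) ≡ 2 * (w + a + r) + 8
  arith₂ = solve-∀

opposite-pair : ∀ {A M x} s → Setup A M → A x (out s) → A x (out (opp s)) → Result A M
opposite-pair {A} {x = x} s S o o' = complete {w = 0} S refl (bounded S o) paid paid sp ≤-refl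
  where
  L = (x , out s) ∷ (x , out (opp s)) ∷ []
  c : Cl ⟦ L ⟧ x (out s)
  c = base (here refl)
  c' : Cl ⟦ L ⟧ x (out (opp s))
  c' = base (there (here refl))
  sp : Span A all x x 6
  sp = record
    { verts = L ; inside = o ∷ o' ∷ [] ; a≤b = ≤-refl ; cost = ≤-refl
    ; spans = λ {z} {y} x≤z z≤x _ → subst (λ z → Cl ⟦ L ⟧ z y) (≤-antisym x≤z z≤x)
                (every-row {Cl ⟦ L ⟧ x} s (between s c c') c c' y) }

data Triple (s : Side) : Row → Row → Row → Set where
  omo′ : Triple s (out s) mid (out (opp s))
  oo′m : Triple s (out s) (out (opp s)) mid
  oo′o : Triple s (out s) (out (opp s)) (out s)

triple-fills : ∀ {S x s y₁ y₂ y₃} → Triple s y₁ y₂ y₃ → Cl S x y₁ → Cl S (1 + x) y₂ → Cl S (2 + x) y₃ →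
               ∀ y → Cl S (1 + x) y
triple-fills {S} {x} {s} omo′ c₁ c₂ c₃ = every-row {Cl S (1 + x)} s c₂ (cornerʳ out~mid c₁ c₂) (cornerˡ mid~out c₂ c₃)
triple-fills {S} {x} {s} oo′m c₁ c₂ c₃ = every-row {Cl S (1 + x)} s m (cornerʳ out~mid c₁ m) c₂
  where m = cornerˡ out~mid c₂ c₃
triple-fills {S} {x} {s} oo′o c₁ c₂ c₃ = every-row {Cl S (1 + x)} s (between s o c₂) o c₂
  where o = across c₁ c₃

triple : ∀ {A M x s y₁ y₂ y₃} → Setup A M → Triple s y₁ y₂ y₃ → A x y₁ → A (1 + x) y₂ → A (2 + x) y₃ →
         Result A M
triple {A} {x = x} {y₁ = y₁} {y₂} {y₃} S t a₁ a₂ a₃ =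
  complete {w = 2} S refl (bounded S a₃) paid paid sp (n≤1+n 11)
  where
  L = (x , y₁) ∷ (1 + x , y₂) ∷ (2 + x , y₃) ∷ []
  full : ∀ y → Cl ⟦ L ⟧ (1 + x) y
  full = triple-fills t (base (here refl)) (base (there (here refl))) (base (there (there (here refl))))
  spans' : ∀ {z y} → x ≤ z → z ≤ 2 + x → y ∈ᴷ all → Cl ⟦ L ⟧ z y
  spans' {y = y} x≤z z≤2+x y∈ with m≤n⇒m<n∨m≡n z≤2+x
  ... | inj₂ refl = fillʳ {K = all} (λ _ → full _) any (base (there (there (here refl)))) y∈
  ... | inj₁ (s≤s z≤1+x) with ≤-one x≤z z≤1+x
  ...   | inj₁ refl = fillˡ {K = all} (λ _ → full _) any (base (here refl)) y∈
  ...   | inj₂ refl = full y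
  sp : Span A all x (2 + x) 9
  sp = record { verts = L ; inside = a₁ ∷ a₂ ∷ a₃ ∷ [] ; a≤b = m≤n+m x 2 ; cost = ≤-refl ; spans = spans' }

rainbowʳ : ∀ {A M x} s → Setup A M → A x (out s) → A (1 + x) mid → A (1 + x) (out (opp s)) → Result A M
rainbowʳ {A} {x = x} s S o m o' with N? (A? S) all (2 + x)
... | yes (mid , _ , p) = triple {s = s} S oo′m o o' p
... | yes (out s' , _ , p) with same-or-opp s s'
...   | inj₁ refl = triple S oo′o o o' p
...   | inj₂ refl = triple S omo′ o m p
rainbowʳ {A} {x = x} s S o m o' | no ¬n = complete {w = 1} S refl (bounded S m) paid (free ¬n) sp ≤-refl
  where
  L = (x , out s) ∷ (1 + x , mid) ∷ (1 + x , out (opp s)) ∷ []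
  cₒ : Cl ⟦ L ⟧ x (out s)
  cₒ = base (here refl)
  cₘ : Cl ⟦ L ⟧ (1 + x) mid
  cₘ = base (there (here refl))
  full : ∀ y → Cl ⟦ L ⟧ (1 + x) y
  full = every-row {Cl ⟦ L ⟧ (1 + x)} s cₘ (cornerʳ out~mid cₒ cₘ) (base (there (there (here refl))))
  spans' : ∀ {z y} → z ≡ x ⊎ z ≡ 1 + x → y ∈ᴷ all → Cl ⟦ L ⟧ z y
  spans' (inj₁ refl) y∈ = fillˡ {K = all} (λ _ → full _) any cₒ y∈
  spans' {y = y} (inj₂ refl) y∈ = full y
  sp : Span A all x (1 + x) 9
  sp = record { verts = L ; inside = o ∷ m ∷ o' ∷ [] ; a≤b = n≤1+n x ; cost = ≤-refl
              ; spans = λ x≤z z≤1+x → spans' (≤-one x≤z z≤1+x) }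

rainbowˡ : ∀ {A M x} s → Setup A M → A (1 + x) (out s) → A x mid → A x (out (opp s)) → Result A M
rainbowˡ {A} {M} {x} s S o m o' = Result-unreflect S
  (rainbowʳ {x = M ∸ (1 + x)} s (reflect-Setup S) (reflect-∋ A {x = 1 + x} eq o) (reflect-∋ A {x = x} eq' m) (reflect-∋ A {x = x} eq' o'))
  where
  eq : (M ∸ (1 + x)) + (1 + x) ≡ M
  eq = m∸n+n≡m (bounded S o)
  eq' : suc (M ∸ (1 + x)) + x ≡ M
  eq' = trans (sym (+-suc _ x)) eq

widen-toll : ∀ {A M s p τ} → Setup A M → Toll (LeftEmpty A (two s) p × A p (out s) × A p mid) τ →
             Result A M ⊎ Toll (LeftEmpty A all p) τ
widen-toll S paid = inj₂ paid
widen-toll {p = zero} S (free _) = inj₂ (free λ ())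
widen-toll {A} {s = s} {suc x} S (free (le , o , m)) with A? S x (out (opp s))
... | yes o' = inj₁ (rainbowʳ (opp s) S o' m (subst (A (suc x) ∘ out) (sym (opp-involutive s)) o))
... | no ¬o' = inj₂ (free λ { refl (y , _ , p) →
  every-row {λ y → ¬ A x y} s (λ m' → le refl (_ , middle , m')) (λ o'' → le refl (_ , outer , o'')) ¬o' y p })

growˡ : ∀ {S p b s} → (∀ {x} → p ≤ x → x ≤ b → Cl S x mid) → Cl S b (out s) →
        ∀ r {x} → r + x ≡ b → p ≤ x → Cl S x (out s)
growˡ m o zero refl p≤x = o
growˡ m o (suc r) {x} eq p≤x =
  cornerˡ mid~out (m p≤x (subst (x ≤_) eq (m≤n+m x (suc r))))
    (growˡ m o r (trans (+-suc r x) eq) (m≤n⇒m≤1+n p≤x))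

growʳ : ∀ {S c d s} → (∀ {x} → c ≤ x → x ≤ d → Cl S x mid) → Cl S c (out s) →
        ∀ r → r + c ≤ d → Cl S (r + c) (out s)
growʳ m o zero le = o
growʳ {c = c} m o (suc r) le =
  cornerʳ out~mid (growʳ m o r (≤-trans (n≤1+n _) le)) (m (m≤n+m c (suc r)) le)

module _ {A : Config} {M : ℕ} (S : Setup A M) where

  open Arm

  capped-arm : ∀ {s b} → Arm A s b → A (1 + b) (out (opp s)) → Result A M
  capped-arm {s} {b} α o with widen-toll S (left α)
  ... | inj₁ res = res
  ... | inj₂ left' = complete {w = suc (width α)} S (cong suc (extent α)) (bounded S o) left' paid sp
    (≤-trans (≤-reflexive (arith₁ (price α) (toll α))) (≤-trans (+-monoˡ-≤ 4 (bound α)) (≤-reflexive (arith₂ (width α)))))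
    where
    arith₁ : ∀ t τ → 3 + t + (τ + 1) ≡ t + τ + 4
    arith₁ = solve-∀
    arith₂ : ∀ w → 2 * w + 6 + 4 ≡ 2 * suc w + 8
    arith₂ = solve-∀
    L = (1 + b , out (opp s)) ∷ verts (block α)
    old : ∀ {x y} → start α ≤ x → x ≤ b → y ∈ᴷ two s → Cl ⟦ L ⟧ x y
    old p≤x x≤b y∈ = Cl-mono there (spans (block α) p≤x x≤b y∈)
    new : Cl ⟦ L ⟧ (1 + b) (out (opp s))
    new = base (here refl)
    full : ∀ {x} → start α ≤ x → x ≤ b → ∀ y → Cl ⟦ L ⟧ x y
    full {x} p≤x x≤b = every-row {Cl ⟦ L ⟧ x} s (old p≤x x≤b middle) (old p≤x x≤b outer)
      (growˡ (λ p≤x x≤b → old p≤x x≤b middle) (cornerˡ mid~out (old (a≤b (block α)) ≤-refl middle) new)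
        (b ∸ x) (m∸n+n≡m x≤b) p≤x)
    spans' : ∀ {x y} → start α ≤ x → x ≤ 1 + b → y ∈ᴷ all → Cl ⟦ L ⟧ x y
    spans' {y = y} p≤x x≤1+b y∈ with m≤n⇒m<n∨m≡n x≤1+b
    ... | inj₁ (s≤s x≤b) = full p≤x x≤b y
    ... | inj₂ refl = fillʳ {K = all} (λ _ → full (a≤b (block α)) ≤-refl _) any new y∈
    sp : Span A all (start α) (1 + b) (3 + price α)
    sp = record
      { verts = L ; inside = o ∷ inside (block α) ; a≤b = m≤n⇒m≤1+n (a≤b (block α)) ; spans = spans'
      ; cost = ≤-trans (≤-reflexive (*-suc 3 _)) (+-monoʳ-≤ 3 (cost (block α))) }

  bridged : ∀ {s p b d t t'} → Span A (two s) p b t → Span A (two (opp s)) (2 + b) d t' → Span A all p d (t + t')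
  bridged {s} {p} {b} {d} {t} {t'} σ σ' = record
    { verts = L ; inside = All.++⁺ (inside σ) (inside σ')
    ; a≤b = ≤-trans (a≤b σ) (≤-trans (m≤n+m b 2) (a≤b σ')) ; spans = λ {x} {y} p≤x x≤d _ → full p≤x x≤d y
    ; cost = ≤-trans (≤-reflexive (trans (cong (3 *_) (length-++ (verts σ))) (*-distribˡ-+ 3 (length (verts σ)) _)))
                     (+-mono-≤ (cost σ) (cost σ')) }
    where
    L = verts σ ++ verts σ'
    Z = Cl ⟦ L ⟧
    τ : ∀ {x y} → p ≤ x → x ≤ b → y ∈ᴷ two s → Z x y
    τ p≤x x≤b y∈ = Cl-mono ∈-++⁺ˡ (spans σ p≤x x≤b y∈)
    τ' : ∀ {x y} → 2 + b ≤ x → x ≤ d → y ∈ᴷ two (opp s) → Z x y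
    τ' c≤x x≤d y∈ = Cl-mono (∈-++⁺ʳ (verts σ)) (spans σ' c≤x x≤d y∈)
    m : Z (1 + b) mid
    m = across (τ (a≤b σ) ≤-refl middle) (τ' ≤-refl (a≤b σ') middle)
    o : Z (1 + b) (out s)
    o = cornerʳ out~mid (τ (a≤b σ) ≤-refl outer) m
    o' : Z (1 + b) (out (opp s))
    o' = cornerˡ mid~out m (τ' ≤-refl (a≤b σ') outer)
    full : ∀ {x} → p ≤ x → x ≤ d → ∀ y → Z x y
    full {x} p≤x x≤d with <-cmp x (1 + b)
    ... | tri≈ _ refl _ = every-row {Z x} s m o o'
    ... | tri< (s≤s x≤b) _ _ = every-row {Z x} s (τ p≤x x≤b middle) (τ p≤x x≤b outer)
      (growˡ (λ p≤x x≤b → τ p≤x x≤b middle) (cornerˡ mid~out (τ (a≤b σ) ≤-refl middle) o')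
        (b ∸ x) (m∸n+n≡m x≤b) p≤x)
    ... | tri> _ _ c≤x = every-row {Z x} s (τ' c≤x x≤d middle)
      (subst (λ x → Z x (out s)) eq
        (growʳ (λ c≤x x≤d → τ' c≤x x≤d middle) (cornerʳ out~mid o (τ' ≤-refl (a≤b σ') middle))
          (x ∸ (2 + b)) (subst (_≤ d) (sym eq) x≤d)))
      (τ' c≤x x≤d outer)
      where eq = m∸n+n≡m c≤x

  facing-arms : ∀ {s b c'} → c' + (2 + b) ≡ M → Arm A s b → Arm (reflect M A) (opp s) c' → Result A M
  facing-arms {s} {b} {c'} ec α β with widen-toll S (left α) | widen-toll (reflect-Setup S) (left β)
  ... | inj₁ res | _ = res
  ... | inj₂ _ | inj₁ res = Result-unreflect S res
  ... | inj₂ leftα | inj₂ leftβ =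
    complete {w = width α + width β + 2} S ed (subst (d ≤_) ed' (m≤m+n d (start β))) leftα (rightβ leftβ)
      (bridged (block α) (Span-unreflect (bounded S) ed' (swap-+ (2 + b) c' ec) (block β)))
      (≤-trans (≤-reflexive (arith₁ (price α) (price β) (toll α) (toll β)))
        (≤-trans (+-mono-≤ (bound α) (bound β)) (≤-reflexive (arith₂ (width α) (width β)))))
    where
    d = width β + (2 + b)
    ed : width α + width β + 2 + start α ≡ d
    ed = trans (arith₀ (width α) (width β) (start α)) (cong (λ b → width β + (2 + b)) (extent α))
      where
      arith₀ : ∀ w w' p → w + w' + 2 + p ≡ w' + (2 + (w + p))
      arith₀ = solve-∀
    ed' : d + start β ≡ M
    ed' = trans (trans (arith₀ (width β) b (start β)) (cong (_+ (2 + b)) (extent β))) ec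
      where
      arith₀ : ∀ w b p → w + (2 + b) + p ≡ w + p + (2 + b)
      arith₀ = solve-∀
    rightβ : ∀ {τ} → Toll (LeftEmpty (reflect M A) all (start β)) τ → Toll (¬ N A all (suc d)) τ
    rightβ paid = paid
    rightβ (free le) = free λ n → let ez = m∸n+n≡m (bounded S (proj₂ (proj₂ n))) in
      le (complement-≡ (swap-+ (start β) d ed') (trans (sym (+-suc _ d)) ez)) (N-reflect ez n)
    arith₁ : ∀ t t' τ τ' → t + t' + (τ + τ') ≡ t + τ + (t' + τ')
    arith₁ = solve-∀
    arith₂ : ∀ w w' → 2 * w + 6 + (2 * w' + 6) ≡ 2 * (w + w' + 2) + 8
    arith₂ = solve-∀
Seed-narrow : ∀ {A s p q} → Seed A s p q → q ≤ 1 + p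
Seed-narrow (flat _ _) = n≤1+n _
Seed-narrow (up _ _) = ≤-refl
Seed-narrow (down _ _) = ≤-refl

module _ {A : Config} {M : ℕ} (S : Setup A M) where

  complement : ∀ {x y} → A x y → (M ∸ x) + x ≡ M
  complement p = m∸n+n≡m (bounded S p)

  N-complement : ∀ {K x} → N A K x → (M ∸ x) + x ≡ M
  N-complement (_ , _ , p) = complement p

  touchingʳ : ∀ {s a b p q d} → Chain (N A (two s)) a b → a ≤ p → Seed A s p q → q ≤ b →
              A d (out (opp s)) → p ≤ d → d ≤ 1 + b → Result A M
  touchingʳ {s} {a} {b} {p} {q} {d} ch a≤p seed q≤b o p≤d d≤1+b with d ≤? q
  ... | yes d≤q = within seed d≤q
    where
    within : ∀ {q} → Seed A s p q → d ≤ q → Result A M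
    within (flat o' m) d≤q with ≤-antisym d≤q p≤d
    ... | refl = opposite-pair s S o' o
    within (up o' m) d≤q with ≤-one p≤d d≤q
    ... | inj₁ refl = opposite-pair s S o' o
    ... | inj₂ refl = rainbowʳ s S o' m o
    within (down m o') d≤q with ≤-one p≤d d≤q
    ... | inj₁ refl = rainbowˡ s S o' m o
    ... | inj₂ refl = opposite-pair s S o' o
  touchingʳ {d = zero} ch a≤p seed q≤b o p≤d d≤1+b | no d≰q = contradiction z≤n d≰q
  touchingʳ {s} {a} {b} {p} {q} {suc e} ch a≤p seed q≤b o p≤d (s≤s e≤b) | no d≰q = beyond (≤-pred (≰⇒> d≰q))
    where
    a≤q : a ≤ q
    a≤q = ≤-trans a≤p (Seed-ordered seed)
    arm-to : ∀ {f} → q ≤ f → f ≤ b → N A (two s) f → Arm A s f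
    arm-to q≤f f≤b n =
      arm (A? S) (subchain ch ≤-refl (≤-trans a≤q q≤f) f≤b (first ch) n) a≤p seed q≤f
    beyond : q ≤ e → Result A M
    beyond q≤e with N? (A? S) (two s) e
    ... | yes n = capped-arm S (arm-to q≤e e≤b n) o
    ... | no ¬n with m≤n⇒m<n∨m≡n q≤e | m≤n⇒m<n∨m≡n e≤b
    ...   | inj₂ refl | _ = contradiction (Seed-last seed) ¬n
    ...   | inj₁ _ | inj₂ refl = contradiction (last ch) ¬n
    ...   | inj₁ (s≤s {n = f} q≤f) | inj₁ e<b
      with gapless ch (≤-trans a≤q q≤f) (≤-trans (n≤1+n _) e<b) | gapless ch (≤-trans a≤q q≤e) e<b
    ...     | inj₂ n | _ = contradiction n ¬n
    ...     | _ | inj₁ n = contradiction n ¬n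
    ...     | inj₁ n | inj₂ (_ , outer , o') = opposite-pair s S o' o
    ...     | inj₁ n | inj₂ (_ , middle , m) =
      facing-arms S (complement o) (arm-to q≤f (≤-trans (n≤1+n f) e≤b) n)
        (arm (reflect-dec M (A? S)) (Chain-point (_ , middle , m')) ≤-refl (flat o' m') ≤-refl)
      where
      m' = reflect-∋ A {x = 2 + f} (complement o) m
      o' = reflect-∋ A {x = 2 + f} (complement o) o

module _ {A : Config} {M : ℕ} (S : Setup A M) where

  touching : ∀ {s a b p q d} → Chain (N A (two s)) a b → a ≤ p → Seed A s p q → q ≤ b →
             A d (out (opp s)) → a ≤ 1 + d → d ≤ 1 + b → Result A M
  touching {s} {a} {b} {p} {q} {d} ch a≤p seed q≤b o a≤1+d d≤1+b with p ≤? d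
  ... | yes p≤d = touchingʳ S ch a≤p seed q≤b o p≤d d≤1+b
  ... | no p≰d = Result-unreflect S
    (touchingʳ (reflect-Setup S) (Chain-reflect ea eb ch) (complement-≤ (swap-+ q (M ∸ q) eq) (swap-+ b (M ∸ b) eb) q≤b)
      (Seed-reflect ep eq seed) (complement-≤ (swap-+ a (M ∸ a) ea) (swap-+ p (M ∸ p) ep) a≤p)
      (reflect-∋ A (complement S o) o)
      (complement-≤ (swap-+ d (M ∸ d) ed) (swap-+ q (M ∸ q) eq) (≤-trans (<⇒≤ (≰⇒> p≰d)) (Seed-ordered seed)))
      (complement-≤ (trans (+-suc a (M ∸ a)) (cong suc (swap-+ a (M ∸ a) ea))) (cong suc (swap-+ d (M ∸ d) ed)) a≤1+d))
    where
    ea : (M ∸ a) + a ≡ M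
    ea = N-complement S (first ch)
    eb : (M ∸ b) + b ≡ M
    eb = N-complement S (last ch)
    ep : (M ∸ p) + p ≡ M
    ep = N-complement S (Seed-first seed)
    eq : (M ∸ q) + q ≡ M
    eq = N-complement S (Seed-last seed)
    ed : (M ∸ d) + d ≡ M
    ed = complement S o

  -- The left block is lengthened along the middle row until it touches the far outer row or
  -- reaches a gap, across which the right block faces it.
  advance : ∀ {s a b c d p q p' q' β} r → r + (2 + b) ≡ β →
            Chain (N A (two s)) a b → a ≤ p → Seed A s p q → q ≤ b →
            Chain (N A (two (opp s))) c d → c ≤ 2 + b → Seed A (opp s) p' q' → q' ≤ d →
            β ≤ q' → A β (out (opp s)) → Result A M
  advance {s} {a} {b} {c} {d} {p} {q} {p'} {q'} {β} r eβ ch a≤p seed q≤b ch' c≤2+b seed' q'≤d β≤q' o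
    with N? (A? S) (two (opp s)) (1 + b)
  ... | yes (_ , outer , o') = touching ch a≤p seed q≤b o' (≤-trans (ordered ch) (m≤n+m b 2)) ≤-refl
  ... | yes (_ , middle , m) = next r eβ
    where
    longer : Chain (N A (two s)) a (1 + b)
    longer = Chain-++ (m≤n⇒m≤1+n (ordered ch)) (n≤1+n _) (n≤1+n b) ch (Chain-point (_ , middle , m))
    next : ∀ r → r + (2 + b) ≡ β → Result A M
    next zero refl = touching longer a≤p seed (m≤n⇒m≤1+n q≤b) o (≤-trans (ordered ch) (m≤n+m b 3)) ≤-refl
    next (suc r) eβ = advance r (trans (+-suc r (2 + b)) eβ) longer a≤p seed (m≤n⇒m≤1+n q≤b)
      ch' (m≤n⇒m≤1+n c≤2+b) seed' q'≤d β≤q' o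
  ... | no ¬n = facing-arms S ec (arm (A? S) ch a≤p seed q≤b)
      (arm (reflect-dec M (A? S)) (Chain-reflect ec ed (subchain ch' c≤2+b 2+b≤d ≤-refl n (last ch')))
        (complement-≤ (swap-+ q' (M ∸ q') eq') (swap-+ d (M ∸ d) ed) q'≤d)
        (Seed-reflect ep' eq' seed')
        (complement-≤ (swap-+ (2 + b) _ ec) (swap-+ p' (M ∸ p') ep') 2+b≤p'))
    where
    2+b≤β : 2 + b ≤ β
    2+b≤β = subst (2 + b ≤_) eβ (m≤n+m (2 + b) r)
    2+b≤d : 2 + b ≤ d
    2+b≤d = ≤-trans 2+b≤β (≤-trans β≤q' q'≤d)
    n : N A (two (opp s)) (2 + b)
    n with m≤n⇒m<n∨m≡n c≤2+b
    ... | inj₂ refl = first ch'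
    ... | inj₁ (s≤s c≤1+b) = fromInj₂ (λ n → contradiction n ¬n) (gapless ch' c≤1+b 2+b≤d)
    2+b≤p' : 2 + b ≤ p'
    2+b≤p' with m≤n⇒m<n∨m≡n (≤-pred (≤-trans 2+b≤β (≤-trans β≤q' (Seed-narrow seed'))))
    ... | inj₁ lt = lt
    ... | inj₂ refl = contradiction (Seed-first seed') ¬n
    ec : (M ∸ (2 + b)) + (2 + b) ≡ M
    ec = N-complement S n
    ed : (M ∸ d) + d ≡ M
    ed = N-complement S (last ch')
    ep' : (M ∸ p') + p' ≡ M
    ep' = N-complement S (Seed-first seed')
    eq' : (M ∸ q') + q' ≡ M
    eq' = N-complement S (Seed-last seed')

  two-meets-two : ∀ {s s' a b c d p q p' q'} → s' ≡ opp s →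
            Chain (N A (two s)) a b → a ≤ p → Seed A s p q → q ≤ b →
            Chain (N A (two s')) c d → c ≤ p' → Seed A s' p' q' → q' ≤ d →
            c ≤ 2 + b → a ≤ 2 + d → Result A M
  two-meets-two {s} {a = a} {b} {c} {d} refl ch a≤p seed q≤b ch' c≤p' seed' q'≤d c≤2+b a≤2+d
    with Seed-outer seed | Seed-outer seed'
  ... | t , p≤t , t≤q , o | β , p'≤β , β≤q' , o' with β ≤? 1 + b | a ≤? 1 + β | t ≤? 1 + d
  ... | no β≰1+b | _ | _ =
    advance (β ∸ (2 + b)) (m∸n+n≡m (≰⇒> β≰1+b)) ch a≤p seed q≤b ch' c≤2+b seed' q'≤d β≤q' o'
  ... | yes β≤1+b | yes a≤1+β | _ = touching ch a≤p seed q≤b o' a≤1+β β≤1+b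
  ... | yes β≤1+b | no a≰1+β | yes t≤1+d =
    touching ch' c≤p' seed' q'≤d (subst (A t ∘ out) (sym (opp-involutive s)) o) c≤1+t t≤1+d
    where
    c≤1+t : c ≤ 1 + t
    c≤1+t = ≤-trans c≤p' (≤-trans p'≤β (≤-trans (n≤1+n β) (≤-trans (<⇒≤ (≰⇒> a≰1+β)) (≤-trans a≤p (m≤n⇒m≤1+n p≤t)))))
  ... | yes β≤1+b | no a≰1+β | no t≰1+d =
    advance (t ∸ (2 + d)) (m∸n+n≡m (≰⇒> t≰1+d)) ch' c≤p' seed' q'≤d
      (subst (λ s → Chain (N A (two s)) a b) (sym (opp-involutive s)) ch) a≤2+d
      (subst (λ s → Seed A s _ _) (sym (opp-involutive s)) seed) q≤b t≤q
      (subst (A t ∘ out) (sym (opp-involutive s)) o)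

  two-meets-one : ∀ {s a b c d p q} →
            Chain (N A (two s)) a b → a ≤ p → Seed A s p q → q ≤ b →
            Chain (N A (one (out (opp s)))) c d → c ≤ 1 + b → a ≤ 1 + d → Result A M
  two-meets-one {a = a} {c = c} ch a≤p seed q≤b ch' c≤1+b a≤1+d with a ≤? 1 + c | first ch' | last ch'
  ... | yes a≤1+c | _ , single , o | _ = touching ch a≤p seed q≤b o a≤1+c c≤1+b
  two-meets-one {a = zero} ch a≤p seed q≤b ch' c≤1+b a≤1+d | no a≰1+c | _ | _ = contradiction z≤n a≰1+c
  two-meets-one {a = suc a} {c = c} ch a≤p seed q≤b ch' c≤1+b (s≤s a≤d) | no a≰1+c | _ | _ , single , o
    with m≤n⇒m<n∨m≡n a≤d
  ... | inj₂ refl = touching ch a≤p seed q≤b o ≤-refl (≤-trans (n≤1+n a) (m≤n⇒m≤1+n (ordered ch)))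
  ... | inj₁ a<d with gapless ch' (≤-trans (n≤1+n c) (≤-pred (≰⇒> a≰1+c))) a<d
  ...   | inj₁ (_ , single , o') =
    touching ch a≤p seed q≤b o' ≤-refl (≤-trans (n≤1+n a) (m≤n⇒m≤1+n (ordered ch)))
  ...   | inj₂ (_ , single , o') = touching ch a≤p seed q≤b o' (n≤1+n _) (m≤n⇒m≤1+n (ordered ch))

  one-meets-oneʳ : ∀ {s s' a b c d} → s' ≡ opp s →
            Chain (N A (one (out s))) a b → Chain (N A (one (out s'))) c d → a ≤ c → c ≤ b → Result A M
  one-meets-oneʳ {s} {a = a} {b} {c} refl ch ch' a≤c c≤b with first ch' | A? S c (out s)
  ... | _ , single , o' | yes o = opposite-pair s S o o'
  ... | _ , single , o' | no ¬o with m≤n⇒m<n∨m≡n a≤c | m≤n⇒m<n∨m≡n c≤b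
  ...   | inj₂ refl | _ = contradiction (first ch) λ { (_ , single , o) → ¬o o }
  ...   | inj₁ _ | inj₂ refl = contradiction (last ch) λ { (_ , single , o) → ¬o o }
  ...   | inj₁ (s≤s a≤x) | inj₁ c<b with gapless ch a≤x (≤-trans (n≤1+n _) c<b) | gapless ch a≤c c<b
  ...     | inj₂ (_ , single , o) | _ = contradiction o ¬o
  ...     | _ | inj₁ (_ , single , o) = contradiction o ¬o
  ...     | inj₁ (_ , single , o₁) | inj₂ (_ , single , o₃) = triple S oo′o o₁ o' o₃

  one-meets-one : ∀ {s a b c d} → Chain (N A (one (out s))) a b → Chain (N A (one (out (opp s)))) c d →
                  c ≤ b → a ≤ d → Result A M
  one-meets-one {s} {a} {c = c} ch ch' c≤b a≤d with ≤-total a c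
  ... | inj₁ a≤c = one-meets-oneʳ refl ch ch' a≤c c≤b
  ... | inj₂ c≤a = one-meets-oneʳ (sym (opp-involutive s)) ch' ch c≤a a≤d
-- The rectangles process.

data Touch : Row → Row → ℕ → Set where
  same     : ∀ {y} → Touch y y 2
  adjacent : ∀ {y y'} → y ~ y' → Touch y y' 1
  opposite : ∀ {s s'} → s' ≡ opp s → Touch (out s) (out s') 0

Touch-≤2 : ∀ {y y' δ} → Touch y y' δ → δ ≤ 2
Touch-≤2 same = ≤-refl
Touch-≤2 (adjacent _) = n≤1+n 1
Touch-≤2 (opposite _) = z≤n

record Hull (a b c d lo hi : ℕ) : Set where
  constructor hull
  field
    lo≤a : lo ≤ a
    b≤hi : b ≤ hi
    lo≤c : lo ≤ c
    d≤hi : d ≤ hi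

Hull-swap : ∀ {a b c d lo hi} → Hull a b c d lo hi → Hull c d a b lo hi
Hull-swap (hull w x y z) = hull y z w x

Chain-join : ∀ {P a b c d} → Chain P a b → Chain P c d → c ≤ 2 + b → a ≤ 2 + d →
             ∃ λ lo → ∃ λ hi → Chain P lo hi × Hull a b c d lo hi
Chain-join {a = a} {b} {c} {d} ch ch' c≤2+b a≤2+d with ≤-total a c | ≤-total b d
... | inj₁ a≤c | inj₁ b≤d = a , d , Chain-++ a≤c c≤2+b b≤d ch ch' , hull ≤-refl b≤d a≤c ≤-refl
... | inj₁ a≤c | inj₂ d≤b = a , b , ch , hull ≤-refl ≤-refl a≤c d≤b
... | inj₂ c≤a | inj₁ b≤d = c , d , ch' , hull c≤a b≤d ≤-refl ≤-refl
... | inj₂ c≤a | inj₂ d≤b = c , b , Chain-++ c≤a a≤2+d d≤b ch' ch , hull c≤a ≤-refl ≤-refl d≤b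

-- Goal stays abstract: a meeting that occupies all three rows yields a cheap spanning list when
-- there are three rows, and a contradiction when there are fewer.
record Meetings (A : Config) (Goal : Set) : Set where
  field
    one-one : ∀ {s a b c d} → Chain (N A (one (out s))) a b → Chain (N A (one (out (opp s)))) c d →
              c ≤ b → a ≤ d → Goal
    two-one : ∀ {s a b c d p q} → Chain (N A (two s)) a b → a ≤ p → Seed A s p q → q ≤ b →
              Chain (N A (one (out (opp s)))) c d → c ≤ 1 + b → a ≤ 1 + d → Goal
    two-two : ∀ {s s' a b c d p q p' q'} → s' ≡ opp s →
              Chain (N A (two s)) a b → a ≤ p → Seed A s p q → q ≤ b →
              Chain (N A (two s')) c d → c ≤ p' → Seed A s' p' q' → q' ≤ d →
              c ≤ 2 + b → a ≤ 2 + d → Goal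

module Merging {A : Config} {Goal : Set} (meetings : Meetings A Goal) where

  open Meetings meetings

  data Cert : Kind → ℕ → ℕ → Set where
    line  : ∀ {y a b} → Chain (N A (one y)) a b → Cert (one y) a b
    strip : ∀ {s a b p q} → Chain (N A (two s)) a b → a ≤ p → Seed A s p q → q ≤ b → Cert (two s) a b
    whole : ∀ {a b} → Chain (N A all) a b → Goal → Cert all a b

  Cert-chain : ∀ {K a b} → Cert K a b → Chain (N A K) a b
  Cert-chain (line ch) = ch
  Cert-chain (strip ch _ _ _) = ch
  Cert-chain (whole ch _) = ch

  record Region : Set where
    constructor region
    field
      {kind} : Kind
      {lo hi} : ℕ
      cert : Cert kind lo hi
  open Region public

  _∋_,_ : Region → ℕ → Row → Set
  R ∋ x , y = y ∈ᴷ kind R × lo R ≤ x × x ≤ hi R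

  record Join {K a b K' c d} (C : Cert K a b) (C' : Cert K' c d) : Set where
    constructor join
    field
      {kind⁺} : Kind
      {lo⁺ hi⁺} : ℕ
      cert⁺ : Cert kind⁺ lo⁺ hi⁺
      K⊆    : ∀ {y} → y ∈ᴷ K → y ∈ᴷ kind⁺
      K'⊆   : ∀ {y} → y ∈ᴷ K' → y ∈ᴷ kind⁺
      hull⁺ : Hull a b c d lo⁺ hi⁺

  Join-swap : ∀ {K a b K' c d} {C : Cert K a b} {C' : Cert K' c d} → Join C C' → Join C' C
  Join-swap (join C f g h) = join C g f (Hull-swap h)

  absorb : ∀ {K a b K' c d} (C : Cert K a b) (C' : Cert K' c d) → (∀ {y} → y ∈ᴷ K' → y ∈ᴷ K) →
           c ≤ 2 + b → a ≤ 2 + d → Join C C'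
  absorb C C' f c≤2+b a≤2+d
    with Chain-join (Cert-chain C) (Chain-map (λ (y , i , p) → y , f i , p) (Cert-chain C')) c≤2+b a≤2+d
  absorb (line _) C' f _ _ | _ , _ , ch , h = join (line ch) id f h
  absorb (strip _ a≤p seed q≤b) C' f _ _ | _ , _ , ch , h@(hull lo≤a b≤hi _ _) =
    join (strip ch (≤-trans lo≤a a≤p) seed (≤-trans q≤b b≤hi)) id f h
  absorb (whole _ g) C' f _ _ | _ , _ , ch , h = join (whole ch g) id f h

  fulfil : ∀ {K a b K' c d} (C : Cert K a b) (C' : Cert K' c d) → Goal → c ≤ 2 + b → a ≤ 2 + d → Join C C'
  fulfil C C' g c≤2+b a≤2+d
    with Chain-join (Chain-map (λ (y , i , p) → y , any , p) (Cert-chain C))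
                    (Chain-map (λ (y , i , p) → y , any , p) (Cert-chain C')) c≤2+b a≤2+d
  ... | _ , _ , ch , h = join (whole ch g) (λ _ → any) (λ _ → any) h

  find-seed : ∀ {s a b c d lo hi} → Chain (N A (one (out s))) a b → Chain (N A (one mid)) c d →
              c ≤ 1 + b → a ≤ 1 + d → Hull a b c d lo hi → ∃ λ p → ∃ λ q → lo ≤ p × Seed A s p q × q ≤ hi
  find-seed {a = a} {b} {c} {d} ch ch' c≤1+b a≤1+d (hull lo≤a b≤hi lo≤c d≤hi)
    with ≤-total a c | first ch | last ch | first ch' | last ch'
  ... | inj₁ a≤c | _ | _ , single , o | _ , single , m | _ with m≤n⇒m<n∨m≡n c≤1+b
  ...   | inj₂ refl = _ , _ , ≤-trans lo≤a (ordered ch) , up o m , ≤-trans (ordered ch') d≤hi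
  ...   | inj₁ (s≤s c≤b) with m≤n⇒m<n∨m≡n c≤b
  ...     | inj₂ refl = _ , _ , lo≤c , flat o m , b≤hi
  ...     | inj₁ c<b with gapless ch a≤c c<b
  ...       | inj₁ (_ , single , o') = _ , _ , lo≤c , flat o' m , ≤-trans c≤b b≤hi
  ...       | inj₂ (_ , single , o') = _ , _ , lo≤c , down m o' , ≤-trans c<b b≤hi
  find-seed {a = a} {b} {c} {d} ch ch' c≤1+b a≤1+d (hull lo≤a b≤hi lo≤c d≤hi)
      | inj₂ c≤a | _ , single , o | _ | _ | _ , single , m with m≤n⇒m<n∨m≡n a≤1+d
  ...   | inj₂ refl = _ , _ , ≤-trans lo≤c (ordered ch') , down m o , ≤-trans (ordered ch) b≤hi
  ...   | inj₁ (s≤s a≤d) with m≤n⇒m<n∨m≡n a≤d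
  ...     | inj₂ refl = _ , _ , lo≤a , flat o m , d≤hi
  ...     | inj₁ a<d with gapless ch' c≤a a<d
  ...       | inj₁ (_ , single , m') = _ , _ , lo≤a , flat o m' , ≤-trans a≤d d≤hi
  ...       | inj₂ (_ , single , m') = _ , _ , lo≤a , up o m' , ≤-trans a<d d≤hi

  stack : ∀ {s a b c d} (ch : Chain (N A (one (out s))) a b) (ch' : Chain (N A (one mid)) c d) →
          c ≤ 1 + b → a ≤ 1 + d → Join (line ch) (line ch')
  stack ch ch' c≤1+b a≤1+d
    with Chain-join (Chain-map (λ { (_ , single , p) → _ , outer , p }) ch)
                    (Chain-map (λ { (_ , single , p) → _ , middle , p }) ch')
                    (m≤n⇒m≤1+n c≤1+b) (m≤n⇒m≤1+n a≤1+d)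
  ... | _ , _ , ch⁺ , h with find-seed ch ch' c≤1+b a≤1+d h
  ...   | _ , _ , lo≤p , seed , q≤hi =
    join (strip ch⁺ lo≤p seed q≤hi) (λ { single → outer }) (λ { single → middle }) h

  absorb-row : ∀ {s y a b c d} (C : Cert (two s) a b) (C' : Cert (one y) c d) →
               ∀ {y' δ} → y' ∈ᴷ two s → Touch y' y δ → c ≤ δ + b → a ≤ δ + d → Join C C'
  absorb-row {s} {mid} C C' _ t cb ad =
    absorb C C' (λ { single → middle }) (≤-trans cb (+-monoˡ-≤ _ (Touch-≤2 t))) (≤-trans ad (+-monoˡ-≤ _ (Touch-≤2 t)))
  absorb-row {s} {out s'} C C' i t cb ad with same-or-opp s s'
  ... | inj₁ refl =
    absorb C C' (λ { single → outer }) (≤-trans cb (+-monoˡ-≤ _ (Touch-≤2 t))) (≤-trans ad (+-monoˡ-≤ _ (Touch-≤2 t)))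
  absorb-row {s} {b = b} {d = d} C@(strip ch a≤p seed q≤b) C'@(line ch') i t cb ad | inj₂ refl =
    fulfil C C' (two-one ch a≤p seed q≤b ch' (near cb) (near ad)) (m≤n⇒m≤1+n (near cb)) (m≤n⇒m≤1+n (near ad))
    where
    δ≤1 : ∀ {y δ} → y ∈ᴷ two s → Touch y (out (opp s)) δ → δ ≤ 1
    δ≤1 middle (adjacent _) = ≤-refl
    δ≤1 outer t = outers s t
      where
      outers : ∀ s {δ} → Touch (out s) (out (opp s)) δ → δ ≤ 1
      outers top (opposite _) = z≤n
      outers bot (opposite _) = z≤n
    near : ∀ {x z} → x ≤ _ + z → x ≤ 1 + z
    near le = ≤-trans le (+-monoˡ-≤ _ (δ≤1 i t))

  Touch-sym : ∀ {y y' δ} → Touch y y' δ → Touch y' y δ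
  Touch-sym same = same
  Touch-sym (adjacent e) = adjacent (~-sym e)
  Touch-sym (opposite {s} refl) = opposite (sym (opp-involutive s))

  merge : ∀ {K a b K' c d y y' δ} (C : Cert K a b) (C' : Cert K' c d) → y ∈ᴷ K → y' ∈ᴷ K' → Touch y y' δ →
          c ≤ δ + b → a ≤ δ + d → Join C C'
  merge C@(whole _ _) C' i i' t cb ad =
    absorb C C' (λ _ → any) (≤-trans cb (+-monoˡ-≤ _ (Touch-≤2 t))) (≤-trans ad (+-monoˡ-≤ _ (Touch-≤2 t)))
  merge C C'@(whole _ _) i i' t cb ad =
    Join-swap (absorb C' C (λ _ → any) (≤-trans ad (+-monoˡ-≤ _ (Touch-≤2 t))) (≤-trans cb (+-monoˡ-≤ _ (Touch-≤2 t))))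
  merge C@(strip _ _ _ _) C'@(line _) i single t cb ad = absorb-row C C' i t cb ad
  merge C@(line _) C'@(strip _ _ _ _) single i' t cb ad = Join-swap (absorb-row C' C i' (Touch-sym t) ad cb)
  merge C@(line _) C'@(line _) single single same cb ad = absorb C C' id cb ad
  merge C@(line ch) C'@(line ch') single single (adjacent out~mid) cb ad = stack ch ch' cb ad
  merge C@(line ch) C'@(line ch') single single (adjacent mid~out) cb ad = Join-swap (stack ch' ch ad cb)
  merge C@(line ch) C'@(line ch') single single (opposite refl) cb ad =
    fulfil C C' (one-one ch ch' cb ad) (≤-trans cb (m≤n+m _ 2)) (≤-trans ad (m≤n+m _ 2))
  merge C@(strip {s} ch a≤p seed q≤b) C'@(strip {s'} ch' c≤p' seed' q'≤d) i i' t cb ad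
    with same-or-opp s s' | ≤-trans cb (+-monoˡ-≤ _ (Touch-≤2 t)) | ≤-trans ad (+-monoˡ-≤ _ (Touch-≤2 t))
  ... | inj₁ refl | cb' | ad' = absorb C C' id cb' ad'
  ... | inj₂ e | cb' | ad' = fulfil C C' (two-two e ch a≤p seed q≤b ch' c≤p' seed' q'≤d cb' ad') cb' ad'

  unite : ∀ {x y x' y' δ} (R R' : Region) → R ∋ x , y → R' ∋ x' , y' → Touch y y' δ → x' ≤ δ + x → x ≤ δ + x' →
          ∃ λ R⁺ → (∀ {x y} → R ∋ x , y → R⁺ ∋ x , y) × (∀ {x y} → R' ∋ x , y → R⁺ ∋ x , y)
  unite {δ = δ} R R' (i , lo≤x , x≤hi) (i' , lo'≤x' , x'≤hi') t x'x xx'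
    with merge (cert R) (cert R') i i' t
           (≤-trans lo'≤x' (≤-trans x'x (+-monoʳ-≤ δ x≤hi)))
           (≤-trans lo≤x (≤-trans xx' (+-monoʳ-≤ δ x'≤hi')))
  ... | join C f g (hull w x y z) = region C
    , (λ (i , l , h) → f i , ≤-trans w l , ≤-trans h x)
    , (λ (i , l , h) → g i , ≤-trans y l , ≤-trans h z)

  point : ∀ {x y} → A x y → ∃ λ R → R ∋ x , y
  point p = region (line (Chain-point (_ , single , p))) , single , ≤-refl , ≤-refl
row : ℕ → Row
row 0 = out top
row 1 = mid
row (suc (suc _)) = out bot

infix 4 _≟ᴿ_
_≟ᴿ_ : DecidableEquality Row
mid ≟ᴿ mid = yes refl
mid ≟ᴿ out _ = no λ ()
out _ ≟ᴿ mid = no λ ()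
out top ≟ᴿ out top = yes refl
out top ≟ᴿ out bot = no λ ()
out bot ≟ᴿ out top = no λ ()
out bot ≟ᴿ out bot = yes refl

row-~ : ∀ {j} → suc j < 3 → row j ~ row (suc j)
row-~ {0} _ = out~mid
row-~ {1} _ = mid~out
row-~ {suc (suc j)} (s≤s (s≤s (s≤s ())))

row-Diff1 : ∀ {j j'} → j < 3 → j' < 3 → Diff1 j j' → row j ~ row j'
row-Diff1 _ j'<3 (inj₁ refl) = row-~ j'<3
row-Diff1 j<3 _ (inj₂ refl) = ~-sym (row-~ j<3)

Diff1-row : ∀ {j j'} → j < 3 → j' < 3 → row j ~ row j' → Diff1 j j'
Diff1-row {0} {1} _ _ e = inj₁ refl
Diff1-row {1} {0} _ _ e = inj₂ refl
Diff1-row {1} {2} _ _ e = inj₁ refl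
Diff1-row {2} {1} _ _ e = inj₂ refl
Diff1-row {1} {suc (suc (suc _))} _ (s≤s (s≤s (s≤s ()))) e
Diff1-row {suc (suc (suc _))} {1} (s≤s (s≤s (s≤s ()))) _ e
Diff1-row {0} {0} _ _ ()
Diff1-row {0} {suc (suc _)} _ _ ()
Diff1-row {1} {1} _ _ ()
Diff1-row {suc (suc _)} {0} _ _ ()
Diff1-row {suc (suc _)} {suc (suc _)} _ _ ()

row-injective : ∀ {j j'} → j < 3 → j' < 3 → row j ≡ row j' → j ≡ j'
row-injective {0} {0} _ _ _ = refl
row-injective {1} {1} _ _ _ = refl
row-injective {2} {2} _ _ _ = refl
row-injective {2} {suc (suc (suc _))} _ (s≤s (s≤s (s≤s ())))
row-injective {suc (suc (suc _))} (s≤s (s≤s (s≤s ())))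
row-injective {0} {1} _ _ ()
row-injective {0} {suc (suc _)} _ _ ()
row-injective {1} {0} _ _ ()
row-injective {1} {suc (suc _)} _ _ ()
row-injective {suc (suc _)} {0} _ _ ()
row-injective {suc (suc _)} {1} _ _ ()

Diff1-≤ : ∀ {a b} → Diff1 a b → a ≤ 1 + b
Diff1-≤ (inj₁ refl) = m≤n+m _ 2
Diff1-≤ (inj₂ refl) = ≤-refl

Diff1-≥ : ∀ {a b} → Diff1 a b → b ≤ 1 + a
Diff1-≥ (inj₁ refl) = ≤-refl
Diff1-≥ (inj₂ refl) = m≤n+m _ 2

embed : ∀ {m n} → VSet m n → Config
embed V x y = ∃ λ i → ∃ λ j → toℕ i ≡ x × row (toℕ j) ≡ y × V (i , j) ≡ true

embed-dec : ∀ {m n} (V : VSet m n) → Decidable (embed V)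
embed-dec V x y = any? λ i → any? λ j → (toℕ i ≟ x) ×-dec ((row (toℕ j) ≟ᴿ y) ×-dec (V (i , j) ≟ᴮ true))

embed-bounded : ∀ {M n} (V : VSet (suc M) n) {x y} → embed V x y → x ≤ M
embed-bounded V (i , _ , refl , _) = ≤-pred (toℕ<n i)

toℕ<3 : ∀ {n} → n ≤ 3 → (j : Fin n) → toℕ j < 3
toℕ<3 n≤3 j = ≤-trans (toℕ<n j) n≤3

module _ {m n : ℕ} (n≤3 : n ≤ 3) (V : VSet m n) {Goal : Set} (meetings : Meetings (embed V) Goal) where

  open Merging meetings

  locate : ∀ {i j} → Infected V (i , j) → ∃ λ R → R ∋ toℕ i , row (toℕ j)
  locate (init p) = point (_ , _ , refl , refl , p)
  locate {i} {j} (step (i₁ , j₁) (i₂ , j₂) u≢w (inj₁ (refl , d₁)) (inj₁ (refl , d₂)) p q)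
    with locate p | locate q
  ... | R₁ , in₁ | R₂ , in₂ = vertical d₁ d₂
    where
    extremes : ∀ {a b c} → suc a ≡ b → suc b ≡ c → c < 3 → row a ≡ out top × row b ≡ mid × row c ≡ out bot
    extremes {zero} refl refl _ = refl , refl , refl
    extremes {suc a} refl refl (s≤s (s≤s (s≤s ())))
    middle-of : ∀ {s} → row (toℕ j₁) ≡ out s → row (toℕ j) ≡ mid → row (toℕ j₂) ≡ out (opp s) →
                ∃ λ R → R ∋ toℕ i , row (toℕ j)
    middle-of {s} e₁ e e₂
      with unite R₁ R₂ (subst (R₁ ∋ toℕ i ,_) e₁ in₁) (subst (R₂ ∋ toℕ i ,_) e₂ in₂) (opposite refl) ≤-refl ≤-refl
    ... | R , f , g with f in₁ | g in₂
    ... | (i₁ , l , h) | (i₂ , _ , _) =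
      R , subst (_∈ᴷ kind R) (sym e) (∈ᴷ-convex s (subst (_∈ᴷ kind R) e₁ i₁) (subst (_∈ᴷ kind R) e₂ i₂)) , l , h
    vertical : Diff1 (toℕ j₁) (toℕ j) → Diff1 (toℕ j₂) (toℕ j) → ∃ λ R → R ∋ toℕ i , row (toℕ j)
    vertical (inj₁ e₁) (inj₁ e₂) =
      contradiction (cong (i ,_) (toℕ-injective (suc-injective (trans e₁ (sym e₂))))) u≢w
    vertical (inj₂ e₁) (inj₂ e₂) =
      contradiction (cong (i ,_) (toℕ-injective (trans (sym e₁) e₂))) u≢w
    vertical (inj₁ e₁) (inj₂ e₂) with extremes e₁ e₂ (toℕ<3 n≤3 j₂)
    ... | r₁ , r , r₂ = middle-of r₁ r r₂
    vertical (inj₂ e₁) (inj₁ e₂) with extremes e₂ e₁ (toℕ<3 n≤3 j₁)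
    ... | r₂ , r , r₁ = middle-of r₁ r r₂
  locate {i} {j} (step (i₁ , j₁) (i₂ , j₂) u≢w (inj₁ (refl , d₁)) (inj₂ (refl , d₂)) p q)
    with locate p | locate q
  ... | R₁ , in₁ | R₂ , in₂
    with unite R₁ R₂ in₁ in₂ (adjacent (row-Diff1 (toℕ<3 n≤3 j₁) (toℕ<3 n≤3 j) d₁)) (Diff1-≤ d₂) (Diff1-≥ d₂)
  ... | R , f , g = R , proj₁ (g in₂) , proj₂ (f in₁)
  locate {i} {j} (step (i₁ , j₁) (i₂ , j₂) u≢w (inj₂ (refl , d₁)) (inj₁ (refl , d₂)) p q)
    with locate p | locate q
  ... | R₁ , in₁ | R₂ , in₂
    with unite R₁ R₂ in₁ in₂ (adjacent (~-sym (row-Diff1 (toℕ<3 n≤3 j₂) (toℕ<3 n≤3 j) d₂))) (Diff1-≥ d₁) (Diff1-≤ d₁)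
  ... | R , f , g = R , proj₁ (f in₁) , proj₂ (g in₂)
  locate {i} {j} (step (i₁ , j₁) (i₂ , j₂) u≢w (inj₂ (refl , d₁)) (inj₂ (refl , d₂)) p q)
    with locate p | locate q
  ... | R₁ , in₁ | R₂ , in₂
    with unite R₁ R₂ in₁ in₂ same (≤-trans (Diff1-≤ d₂) (s≤s (Diff1-≥ d₁))) (≤-trans (Diff1-≤ d₁) (s≤s (Diff1-≥ d₂)))
  ... | R , f , g = R , proj₁ (f in₁) , horizontal d₁ d₂ (proj₂ (f in₁)) (proj₂ (g in₂))
    where
    horizontal : Diff1 (toℕ i₁) (toℕ i) → Diff1 (toℕ i₂) (toℕ i) →
                 lo R ≤ toℕ i₁ × toℕ i₁ ≤ hi R → lo R ≤ toℕ i₂ × toℕ i₂ ≤ hi R → lo R ≤ toℕ i × toℕ i ≤ hi R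
    horizontal (inj₁ e₁) (inj₁ e₂) _ _ =
      contradiction (cong (_, j) (toℕ-injective (suc-injective (trans e₁ (sym e₂))))) u≢w
    horizontal (inj₂ e₁) (inj₂ e₂) _ _ =
      contradiction (cong (_, j) (toℕ-injective (trans (sym e₁) e₂))) u≢w
    horizontal (inj₁ e₁) (inj₂ e₂) (l , _) (_ , h) =
      ≤-trans l (≤-trans (n≤1+n _) (≤-reflexive e₁)) , ≤-trans (≤-trans (n≤1+n _) (≤-reflexive e₂)) h
    horizontal (inj₂ e₁) (inj₁ e₂) (_ , h) (l , _) =
      ≤-trans l (≤-trans (n≤1+n _) (≤-reflexive e₂)) , ≤-trans (≤-trans (n≤1+n _) (≤-reflexive e₁)) h
module _ {M n' : ℕ} (n≤3 : suc n' ≤ 3) (V : VSet (suc M) (suc n')) (perc : Percolates V)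
         {Goal : Set} (meetings : Meetings (embed V) Goal) where

  open Merging meetings

  private
    locateℕ : ∀ {x j} → x ≤ M → j ≤ n' → ∃ λ R → R ∋ x , row j
    locateℕ {x} {j} x≤M j≤n' with locate n≤3 V meetings (perc (fromℕ< (s≤s x≤M) , fromℕ< (s≤s j≤n')))
    ... | R , in′ = R , subst₂ (λ x j → R ∋ x , row j) (toℕ-fromℕ< (s≤s x≤M)) (toℕ-fromℕ< (s≤s j≤n')) in′

    cover-column : ∀ k → k ≤ n' → ∃ λ R → ∀ {j} → j ≤ k → R ∋ 0 , row j
    cover-column zero k≤n' with locateℕ z≤n z≤n
    ... | R , in′ = R , λ { z≤n → in′ }
    cover-column (suc k) k<n' with cover-column k (<⇒≤ k<n') | locateℕ z≤n k<n'
    ... | R , below | R' , in′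
      with unite R R' (below ≤-refl) in′ (adjacent (row-~ (≤-trans (s≤s k<n') n≤3))) z≤n z≤n
    ... | R⁺ , f , g = R⁺ , λ j≤1+k → [ (λ { (s≤s j≤k) → f (below j≤k) }) , (λ { refl → g in′ }) ]′ (m≤n⇒m<n∨m≡n j≤1+k)

    cover-row : ∀ x → x ≤ M → ∃ λ R → (∀ {j} → j ≤ n' → R ∋ 0 , row j) × R ∋ x , row 0
    cover-row zero x≤M with cover-column n' ≤-refl
    ... | R , column = R , column , column z≤n
    cover-row (suc x) x<M with cover-row x (<⇒≤ x<M) | locateℕ x<M z≤n
    ... | R , column , old | R' , new with unite R R' old new same (n≤1+n _) (m≤n+m x 3)
    ... | R⁺ , f , g = R⁺ , f ∘ column , g new

  cover : ∃ λ K → Cert K 0 M × (∀ {j} → j ≤ n' → row j ∈ᴷ K)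
  cover with cover-row M ≤-refl
  ... | R@(region {K} C) , column , (_ , _ , M≤hi) =
    K , subst₂ (Cert K) (n≤0⇒n≡0 (proj₁ (proj₂ (column z≤n)))) (≤-antisym hi≤M M≤hi) C , proj₁ ∘ column
    where
    hi≤M : hi R ≤ M
    hi≤M = embed-bounded V (proj₂ (proj₂ (last (Cert-chain C))))

module _ {m n : ℕ} (n≤3 : n ≤ 3) (B : VSet m n) {S : Config} (S⊆B : ∀ {x y} → S x y → embed B x y) where

  realise : ∀ {x y} → Cl S x y → ∃ λ i → ∃ λ j → toℕ i ≡ x × row (toℕ j) ≡ y × Infected B (i , j)
  realise (base p) with S⊆B p
  ... | i , j , ex , ey , b = i , j , ex , ey , init b
  realise (across {x} p q) with realise p | realise q
  ... | i , j , ex , ey , u | i' , j' , ex' , ey' , w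
    with toℕ-injective (row-injective (toℕ<3 n≤3 j) (toℕ<3 n≤3 j') (trans ey (sym ey')))
  ... | refl = i₁ , j , e₁ , ey ,
    step (i , j) (i' , j) (λ { refl → m≢1+n+m x (trans (sym ex) ex') })
      (inj₂ (refl , inj₁ (trans (cong suc ex) (sym e₁))))
      (inj₂ (refl , inj₂ (trans (cong suc e₁) (sym ex')))) u w
    where
    1+x<m : 1 + x < m
    1+x<m = ≤-trans (≤-reflexive (sym ex')) (<⇒≤ (toℕ<n i'))
    i₁ = fromℕ< 1+x<m
    e₁ : toℕ i₁ ≡ 1 + x
    e₁ = toℕ-fromℕ< 1+x<m
  realise (between {x} s p q) with realise p | realise q
  ... | i , j , ex , ey , u | i' , j' , ex' , ey' , w with toℕ-injective (trans ex (sym ex'))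
  ... | refl = vertical s ey ey'
    where
    Target = ∃ λ i → ∃ λ j → toℕ i ≡ x × row (toℕ j) ≡ mid × Infected B (i , j)
    infect : ∀ {j j'} → toℕ j ≡ 0 → toℕ j' ≡ 2 → Infected B (i , j) → Infected B (i , j') → Target
    infect {j} {j'} e e' u w = i , j₁ , ex , cong row e₁ ,
      step (i , j) (i , j') (λ { refl → contradiction (trans (sym e) e') λ () })
        (inj₁ (refl , inj₁ (trans (cong suc e) (sym e₁)))) (inj₁ (refl , inj₂ (trans (cong suc e₁) (sym e')))) u w
      where
      1<n : 1 < n
      1<n = ≤-trans (≤-reflexive (sym e')) (<⇒≤ (toℕ<n j'))
      j₁ = fromℕ< 1<n
      e₁ : toℕ j₁ ≡ 1
      e₁ = toℕ-fromℕ< 1<n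
    top-index : ∀ j → row (toℕ j) ≡ out top → toℕ j ≡ 0
    top-index j = row-injective {j' = 0} (toℕ<3 n≤3 j) (s≤s z≤n)
    bot-index : ∀ j → row (toℕ j) ≡ out bot → toℕ j ≡ 2
    bot-index j = row-injective {j' = 2} (toℕ<3 n≤3 j) ≤-refl
    vertical : ∀ s → row (toℕ j) ≡ out s → row (toℕ j') ≡ out (opp s) → Target
    vertical top r r' = infect (top-index j r) (bot-index j' r') u w
    vertical bot r r' = infect (top-index j' r') (bot-index j r) w u
  realise (cornerˡ {x} e p q) with realise p | realise q
  ... | i , j , ex , refl , u | i' , j' , ex' , refl , w = i , j' , ex , refl ,
    step (i , j) (i' , j') (λ { refl → m≢1+n+m x {0} (trans (sym ex) ex') })
      (inj₁ (refl , Diff1-row (toℕ<3 n≤3 j) (toℕ<3 n≤3 j') e))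
      (inj₂ (refl , inj₂ (trans (cong suc ex) (sym ex')))) u w
  realise (cornerʳ {x} e p q) with realise p | realise q
  ... | i , j , ex , refl , u | i' , j' , ex' , refl , w = i' , j , ex' , refl ,
    step (i , j) (i' , j') (λ { refl → m≢1+n+m x {0} (trans (sym ex) ex') })
      (inj₂ (refl , inj₁ (trans (cong suc ex) (sym ex'))))
      (inj₁ (refl , Diff1-row (toℕ<3 n≤3 j') (toℕ<3 n≤3 j) (~-sym e))) u w

  Cl⇒Percolates : (∀ i j → Cl S (toℕ i) (row (toℕ {n} j))) → Percolates B
  Cl⇒Percolates full (i , j) with realise (full i j)
  ... | i' , j' , ex , ey , u with toℕ-injective ex | toℕ-injective (row-injective (toℕ<3 n≤3 j') (toℕ<3 n≤3 j) ey)
  ... | refl | refl = u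

total : ∀ {n} → (Fin n → ℕ) → ℕ
total {n} f = sum (map f (allFin n))

total-suc : ∀ {n} (f : Fin (suc n) → ℕ) → total f ≡ f zero + total (f ∘ suc)
total-suc f = cong (λ l → f zero + sum l) (trans (map-tabulate suc f) (sym (map-tabulate id (f ∘ suc))))

total-≤ : ∀ {n} {f g : Fin n → ℕ} → (∀ i → f i ≤ g i) → total f ≤ total g
total-≤ {zero} le = z≤n
total-≤ {suc n} {f} {g} le = subst₂ _≤_ (sym (total-suc f)) (sym (total-suc g)) (+-mono-≤ (le zero) (total-≤ (le ∘ suc)))

total-zero : ∀ n → total {n} (λ _ → 0) ≡ 0
total-zero zero = refl
total-zero (suc n) = trans (total-suc {n} (λ _ → 0)) (total-zero n)

total-bump : ∀ {n} {f g : Fin n → ℕ} k → (∀ i → i ≢ k → f i ≤ g i) → f k ≤ suc (g k) → total f ≤ suc (total g)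
total-bump {suc n} {f} {g} zero le lek =
  subst₂ _≤_ (sym (total-suc f)) (cong suc (sym (total-suc g)))
    (+-mono-≤ lek (total-≤ (λ i → le (suc i) λ ())))
total-bump {suc n} {f} {g} (suc k) le lek =
  subst₂ _≤_ (sym (total-suc f)) (trans (+-suc _ _) (cong suc (sym (total-suc g))))
    (+-mono-≤ (le zero λ ()) (total-bump k (λ i i≢k → le (suc i) λ { refl → i≢k refl }) lek))

module _ {m n : ℕ} where

  _≟ⱽ_ : DecidableEquality (Vertex m n)
  _≟ⱽ_ = ≡-dec Fin._≟_ Fin._≟_

  open DecMembership _≟ⱽ_ using (_∈?_)

  size-≤-length : (A : VSet m n) (L : List (Vertex m n)) → (∀ v → A v ≡ true → v ∈ L) → size A ≤ length L
  size-≤-length A [] A⊆L = ≤-trans (total-≤ λ i → ≤-trans (total-≤ λ j → empty i j) (≤-reflexive (total-zero n))) (≤-reflexive (total-zero m))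
    where
    empty : ∀ i j → (if A (i , j) then 1 else 0) ≤ 0
    empty i j with A (i , j) in e
    ... | false = z≤n
    ... | true = contradiction (A⊆L (i , j) e) λ ()
  size-≤-length A (v@(i₀ , j₀) ∷ L) A⊆L = ≤-trans bump (s≤s (size-≤-length A' L A'⊆L))
    where
    A' : VSet m n
    A' w = if does (w ≟ⱽ v) then false else A w
    A'⊆L : ∀ w → A' w ≡ true → w ∈ L
    A'⊆L w e with w ≟ⱽ v
    ... | no w≢v with A⊆L w e
    ...   | here w≡v = contradiction w≡v w≢v
    ...   | there w∈L = w∈L
    same-elsewhere : ∀ i j → (i , j) ≢ v → (if A (i , j) then 1 else 0) ≤ (if A' (i , j) then 1 else 0)
    same-elsewhere i j ≢v rewrite dec-false ((i , j) ≟ⱽ v) ≢v = ≤-refl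
    one-more : (if A v then 1 else 0) ≤ suc (if A' v then 1 else 0)
    one-more with A v
    ... | true = s≤s z≤n
    ... | false = z≤n
    bump : size A ≤ suc (size A')
    bump = total-bump i₀ (λ i i≢ → total-≤ λ j → same-elsewhere i j λ { refl → i≢ refl })
      (total-bump j₀ (λ j j≢ → same-elsewhere i₀ j λ { refl → j≢ refl }) one-more)

  pick : ∀ {A : VSet m n} {L} → All (uncurry (embed A)) L →
         ∃ λ L' → length L' ≡ length L × (∀ {v} → v ∈ L' → A v ≡ true) ×
                  (∀ {x y} → (x , y) ∈ L → ∃ λ i → ∃ λ j → toℕ i ≡ x × row (toℕ j) ≡ y × (i , j) ∈ L')
  pick [] = [] , refl , (λ ()) , λ ()
  pick ((i , j , ex , ey , a) ∷ as) with pick as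
  ... | L' , len , sound , exhaustive = (i , j) ∷ L' , cong suc len ,
    (λ { (here refl) → a ; (there p) → sound p }) ,
    (λ { (here refl) → i , j , ex , ey , here refl
       ; (there p) → let i , j , ex , ey , q = exhaustive p in i , j , ex , ey , there q })

  minimal⇒⊆ : ∀ {A : VSet m n} → MinimalPercolating A → (L : List (Vertex m n)) → (∀ {v} → v ∈ L → A v ≡ true) →
              Percolates (λ v → does (v ∈? L)) → ∀ v → A v ≡ true → v ∈ L
  minimal⇒⊆ {A} (_ , minimal) L L⊆A perc v a with v ∈? L
  ... | yes v∈L = v∈L
  ... | no v∉L = contradiction perc (minimal _ (sub , v , a , dec-false (v ∈? L) v∉L))
    where
    sub : ∀ w → does (w ∈? L) ≡ true → A w ≡ true
    sub w e with w ∈? L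
    ... | yes w∈L = L⊆A w∈L

minimal-size : ∀ {M n K t} {A : VSet (suc M) n} → n ≤ 3 → MinimalPercolating A → Span (embed A) K 0 M t →
               (∀ (j : Fin n) → row (toℕ j) ∈ᴷ K) → size A ≤ t / 3
minimal-size {M} {n} {t = t} {A} n≤3 min sp rows with pick (inside sp)
... | L , len , sound , exhaustive =
  subst (_≤ t / 3) (m*n/n≡m (size A) 3) (/-monoˡ-≤ 3 (≤-trans (≤-reflexive (*-comm (size A) 3)) (≤-trans (*-monoʳ-≤ 3 size≤) (cost sp))))
  where
  open DecMembership (_≟ⱽ_ {suc M} {n}) using (_∈?_)
  perc : Percolates (λ v → does (v ∈? L))
  perc = Cl⇒Percolates n≤3 _
    (λ p → let i , j , ex , ey , q = exhaustive p in i , j , ex , ey , dec-true ((i , j) ∈? L) q)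
    (λ i j → spans sp z≤n (≤-pred (toℕ<n i)) (rows j))
  size≤ : size A ≤ length (verts sp)
  size≤ = subst (size A ≤_) len (size-≤-length A L (minimal⇒⊆ min L sound perc))

row-index : ∀ {m n} {A : VSet m n} {x k} → n ≤ 3 → k < 3 → embed A x (row k) → k < n
row-index n≤3 k<3 (i , j , _ , ey , _) with row-injective (toℕ<3 n≤3 j) k<3 ey
... | refl = toℕ<n j

point-span : ∀ {A x y} → A x y → Span A (one y) x x 3
point-span {x = x} {y} p = record
  { verts = (x , y) ∷ [] ; inside = p ∷ [] ; a≤b = ≤-refl ; cost = ≤-refl
  ; spans = λ { a≤x x≤a single → base (here (cong (_, y) (≤-antisym x≤a a≤x))) } }

outers-met : ∀ (A : Config) → Meetings A (∀ s → ∃ λ x → A x (out s))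
outers-met A = record
  { one-one = λ {s} ch ch' _ _ → both s (chain-outer ch) (chain-outer ch')
  ; two-one = λ {s} _ _ seed _ ch _ _ → both s (seed-outer seed) (chain-outer ch)
  ; two-two = λ { {s} refl _ _ seed _ _ _ seed' _ _ _ → both s (seed-outer seed) (seed-outer seed') } }
  where
  chain-outer : ∀ {s a b} → Chain (N A (one (out s))) a b → ∃ λ x → A x (out s)
  chain-outer ch with first ch
  ... | _ , single , p = _ , p
  seed-outer : ∀ {s p q} → Seed A s p q → ∃ λ x → A x (out s)
  seed-outer seed = let x , _ , _ , p = Seed-outer seed in x , p
  both : ∀ s → (∃ λ x → A x (out s)) → (∃ λ x → A x (out (opp s))) → ∀ s' → ∃ λ x → A x (out s')
  both s p p' s' with same-or-opp s s'
  ... | inj₁ refl = p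
  ... | inj₂ refl = p'

module _ {M n' : ℕ} (n≤3 : suc n' ≤ 3) (B : VSet (suc M) (suc n')) (perc : Percolates B) where

  open Merging (outers-met (embed B))

  private
    covering = cover n≤3 B perc (outers-met (embed B))

  percolates⇒linked : Chain (N (embed B) all) 0 M
  percolates⇒linked = let _ , C , _ = covering in Chain-map (λ (y , _ , p) → y , any , p) (Cert-chain C)

  percolates⇒outer : ∀ {j s} → j ≤ n' → row j ≡ out s → ∃ λ x → embed B x (out s)
  percolates⇒outer {s = s} j≤n' e with covering
  ... | _ , C , rows = at C (subst (_∈ᴷ _) e (rows j≤n'))
    where
    at : ∀ {K a b} → Cert K a b → out s ∈ᴷ K → ∃ λ x → embed B x (out s)
    at (line ch) single with first ch
    ... | _ , single , p = _ , p
    at (strip _ _ seed _) outer = let x , _ , _ , p = Seed-outer seed in x , p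
    at (whole _ met) any = met s

percolates⇒seed : ∀ {M} (B : VSet (suc M) 2) → Percolates B → ∃ λ p → ∃ λ q → Seed (embed B) top p q
percolates⇒seed B perc with cover (s≤s (s≤s z≤n)) B perc (outers-met (embed B))
... | _ , Merging.line _ , rows with rows z≤n | rows (s≤s z≤n)
...   | single | ()
percolates⇒seed B perc | _ , Merging.strip _ _ seed _ , rows with rows z≤n
... | outer = _ , _ , seed
percolates⇒seed B perc | _ , Merging.whole _ met , _ =
  contradiction (row-index {A = B} {k = 2} (s≤s (s≤s z≤n)) ≤-refl (proj₂ (met bot))) (<⇒≱ ≤-refl)

no-bottom : ∀ {A : Config} → (∀ {x} → ¬ A x (out bot)) → Meetings A ⊥
no-bottom {A} none = record
  { one-one = λ { {top} _ ch _ _ → in-chain ch ; {bot} ch _ _ _ → in-chain ch }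
  ; two-one = λ { {top} _ _ _ _ ch _ _ → in-chain ch ; {bot} _ _ seed _ _ _ _ → in-seed seed }
  ; two-two = λ { {top} refl _ _ _ _ _ _ seed _ _ _ → in-seed seed ; {bot} refl _ _ seed _ _ _ _ _ _ _ → in-seed seed } }
  where
  in-chain : ∀ {a b} → Chain (N A (one (out bot))) a b → ⊥
  in-chain ch with first ch
  ... | _ , single , p = none p
  in-seed : ∀ {p q} → Seed A bot p q → ⊥
  in-seed seed with Seed-outer seed
  ... | _ , _ , _ , p = none p

upper-one : ∀ M (A : VSet (suc M) 1) → MinimalPercolating A → size A ≤ (2 * (suc M + 1)) / 3
upper-one M A min@(perc , _) = answer (cover 1≤3 A perc (no-bottom {embed A} no-bot))
  where
  1≤3 : 1 ≤ 3
  1≤3 = s≤s z≤n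
  no-bot : ∀ {x} → ¬ embed A x (out bot)
  no-bot p = contradiction (row-index {k = 2} 1≤3 ≤-refl p) (<⇒≱ (s≤s (s≤s z≤n)))
  no-mid : ∀ {x} → ¬ embed A x mid
  no-mid p = contradiction (row-index {k = 1} 1≤3 (s≤s (s≤s z≤n)) p) (<⇒≱ (s≤s (s≤s z≤n)))
  open Merging (no-bottom {embed A} no-bot)
  arith : ∀ M → 3 + suc (2 * M) ≡ 2 * (suc M + 1)
  arith = solve-∀
  answer : (∃ λ K → Cert K 0 M × (∀ {j} → j ≤ 0 → row j ∈ᴷ K)) → size A ≤ (2 * (suc M + 1)) / 3
  answer (one _ , line ch , rows) with rows z≤n | first ch
  ... | single | _ , single , p = minimal-size 1≤3 min
    (relax (≤-reflexive (arith M)) (extend (embed-dec A) M (+-identityʳ M) z≤n ch (point-span p))) λ { zero → single }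
  answer (two s , strip _ _ seed _ , _) = ⊥-elim (no-middle seed)
    where
    no-middle : ∀ {s p q} → Seed (embed A) s p q → ⊥
    no-middle (flat _ m) = no-mid m
    no-middle (up _ m) = no-mid m
    no-middle (down m _) = no-mid m
  answer (all , whole _ () , _)

upper-two : ∀ M (A : VSet (suc M) 2) → MinimalPercolating A → size A ≤ (2 * (suc M + 2)) / 3
upper-two M A min@(perc , _) = answer (cover 2≤3 A perc (no-bottom {embed A} no-bot))
  where
  2≤3 : 2 ≤ 3
  2≤3 = s≤s (s≤s z≤n)
  no-bot : ∀ {x} → ¬ embed A x (out bot)
  no-bot p = contradiction (row-index {k = 2} 2≤3 ≤-refl p) (<⇒≱ ≤-refl)
  open Merging (no-bottom {embed A} no-bot)
  open Arm
  answer : (∃ λ K → Cert K 0 M × (∀ {j} → j ≤ 1 → row j ∈ᴷ K)) → size A ≤ (2 * (suc M + 2)) / 3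
  answer (one _ , line _ , rows) with rows z≤n | rows (s≤s z≤n)
  ... | single | ()
  answer (all , whole _ () , _)
  answer (two s , strip ch a≤p seed q≤b , rows) = minimal-size 2≤3 min
    (relax cost≤ (extendˡ (embed-dec A) (embed-bounded A) (start α) (+-identityʳ (start α))
      (subst (start α ≤_) (extent α) (m≤n+m (start α) (width α))) ch (toll⁻ (left α)) ≤-refl (block α)))
    λ { zero → rows z≤n ; (suc zero) → rows (s≤s z≤n) }
    where
    α = arm (embed-dec A) ch a≤p seed q≤b
    toll⁻ : ∀ {τ E F} → Toll (E × F) τ → Toll E τ
    toll⁻ paid = paid
    toll⁻ (free e) = free (proj₁ e)
    arith₁ : ∀ t τ p → t + (τ + 2 * p) ≡ t + τ + 2 * p
    arith₁ = solve-∀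
    arith₂ : ∀ w p → 2 * w + 6 + 2 * p ≡ 2 * (suc (w + p) + 2)
    arith₂ = solve-∀
    cost≤ : price α + (toll α + 2 * start α) ≤ 2 * (suc M + 2)
    cost≤ = ≤-trans (≤-reflexive (arith₁ (price α) (toll α) (start α))) (≤-trans (+-monoˡ-≤ _ (bound α))
      (≤-reflexive (trans (arith₂ (width α) (start α)) (cong (λ M → 2 * (suc M + 2)) (extent α)))))

upper-three : ∀ M (A : VSet (suc M) 3) → MinimalPercolating A → size A ≤ (2 * (suc M + 3)) / 3
upper-three M A min@(perc , _) = minimal-size ≤-refl min (relax (≤-reflexive (arith M)) (result (cover ≤-refl A perc meetings))) λ _ → any
  where
  arith : ∀ M → 2 * M + 8 ≡ 2 * (suc M + 3)
  arith = solve-∀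
  setup : Setup (embed A) M
  setup = record
    { A? = embed-dec A ; bounded = embed-bounded A
    ; linked = percolates⇒linked ≤-refl A perc }
  meetings : Meetings (embed A) (Result (embed A) M)
  meetings = record { one-one = one-meets-one setup ; two-one = two-meets-one setup ; two-two = two-meets-two setup }
  open Merging meetings
  result : (∃ λ K → Cert K 0 M × (∀ {j} → j ≤ 2 → row j ∈ᴷ K)) → Result (embed A) M
  result (one _ , line _ , rows) with rows z≤n | rows (s≤s z≤n)
  ... | single | ()
  result (two top , strip _ _ _ _ , rows) with rows {2} ≤-refl
  ... | ()
  result (two bot , strip _ _ _ _ , rows) with rows {0} z≤n
  ... | ()
  result (all , whole _ res , _) = res
-- Extremal configurations: a short prefix followed by the columns (∅ , r , r) repeated.

Column : Set
Column = Row → Bool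

none upper outers : Column
none _ = false
upper mid = true
upper (out top) = true
upper (out bot) = false
outers mid = false
outers (out _) = true

only : Row → Column
only r y = does (y ≟ᴿ r)

only-true : ∀ {r y} → only r y ≡ true → y ≡ r
only-true {r} {y} e with y ≟ᴿ r
... | yes eq = eq

tail : ℕ → Bool
tail 0 = false
tail 1 = true
tail 2 = true
tail (suc (suc (suc x))) = tail x

motif : Row → List Column → ℕ → Column
motif r [] x y = tail x ∧ only r y
motif r (c ∷ cs) zero = c
motif r (c ∷ cs) (suc x) = motif r cs x

Lone : (ℕ → Column) → ℕ → Row → Set
Lone P x y = ∀ {y'} → P x y' ≡ true → y' ≡ y

Empty : (ℕ → Column) → ℕ → Set
Empty P x = ∀ y → P x y ≡ false

NextToGap : (ℕ → Column) → ℕ → Row → Set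
NextToGap P x y = Lone P x y × (Empty P (suc x) ⊎ ∃ λ z → suc z ≡ x × Empty P z)

next-shift : ∀ {r c cs x y} → NextToGap (motif r cs) x y → NextToGap (motif r (c ∷ cs)) (suc x) y
next-shift (lone , inj₁ e) = lone , inj₁ e
next-shift (lone , inj₂ (z , refl , e)) = lone , inj₂ (suc z , refl , e)

∧-true : ∀ {a b} → a ∧ b ≡ true → b ≡ true
∧-true {true} e = e

tail-next : ∀ {r} x {y} → motif r [] x y ≡ true → NextToGap (motif r []) x y
tail-next {r} x {y} p = lone , gap x p
  where
  lone : Lone (motif r []) x y
  lone p' = trans (only-true {r} (∧-true {tail x} p')) (sym (only-true {r} (∧-true {tail x} p)))
  gap : ∀ x → motif r [] x y ≡ true → Empty (motif r []) (suc x) ⊎ ∃ λ z → suc z ≡ x × Empty (motif r []) z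
  gap 1 _ = inj₂ (0 , refl , λ _ → refl)
  gap 2 _ = inj₁ λ _ → refl
  gap (suc (suc (suc x))) p with gap x p
  ... | inj₁ e = inj₁ e
  ... | inj₂ (z , refl , e) = inj₂ (3 + z , refl , e)

restrict : ∀ {m n} → (ℕ → Column) → VSet m n
restrict P (i , j) = P (toℕ i) (row (toℕ j))

data Essential (n : ℕ) (P : ℕ → Column) (x : ℕ) (y : Row) : Set where
  first-column : x ≡ 0 → Lone P x y → Essential n P x y
  next-to-gap  : NextToGap P x y → Essential n P x y
  sole-in-row  : ∀ {s} → y ≡ out s → (∀ {x'} → P x' (out s) ≡ true → x' ≡ x) → Essential n P x y
  in-only-seed : n ≡ 2 → x ≡ 0 → y ≡ mid → (∀ {x'} → P x' (out top) ≡ true → x' ≡ 0) →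
                 Empty P 1 → Essential n P x y

essential⇒minimal : ∀ {M n'} → suc n' ≤ 3 → (P : ℕ → Column) → (∀ x {y} → P x y ≡ true → Essential (suc n') P x y) →
                    Percolates {suc M} {suc n'} (restrict P) → MinimalPercolating {suc M} {suc n'} (restrict P)
essential⇒minimal {M} {n'} n≤3 P essential perc = perc , minimal
  where
  minimal : ∀ B → ProperSubset B (restrict P) → ¬ Percolates B
  minimal B (B⊆A , (i , j) , a , ¬b) percB = refute (essential x a)
    where
    x = toℕ i
    y = row (toℕ j)
    B⊆P : ∀ {x y} → embed B x y → P x y ≡ true
    B⊆P (i' , j' , refl , refl , b) = B⊆A (i' , j') b
    removed : ¬ embed B x y
    removed (i' , j' , ex , ey , b)
      with toℕ-injective ex | toℕ-injective (row-injective (toℕ<3 n≤3 j') (toℕ<3 n≤3 j) ey)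
    ... | refl | refl = contradiction (trans (sym b) ¬b) λ ()
    connected = percolates⇒linked n≤3 B percB
    lone-removed : Lone P x y → ¬ N (embed B) all x
    lone-removed lone (y' , _ , b) = removed (subst (embed B x) (lone (B⊆P b)) b)
    empty-removed : ∀ {z} → Empty P z → ¬ N (embed B) all z
    empty-removed e (y' , _ , b) = contradiction (trans (sym (B⊆P b)) (e y')) λ ()
    refute : Essential (suc n') P x y → ⊥
    refute (first-column e lone) = lone-removed lone (subst (N (embed B) all) (sym e) (first connected))
    refute (next-to-gap (lone , inj₁ e)) with m≤n⇒m<n∨m≡n (≤-pred (toℕ<n i))
    ... | inj₂ x≡M = lone-removed lone (subst (N (embed B) all) (sym x≡M) (last connected))
    ... | inj₁ x<M = [ lone-removed lone , empty-removed e ]′ (gapless connected z≤n x<M)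
    refute (next-to-gap (lone , inj₂ (z , ez , e))) =
      [ empty-removed e , lone-removed lone ∘ subst (N (embed B) all) ez ]′
        (gapless connected z≤n (≤-trans (≤-reflexive ez) (≤-pred (toℕ<n i))))
    refute (sole-in-row ey sole) with percolates⇒outer n≤3 B percB (≤-pred (toℕ<n j)) ey
    ... | x' , b = removed (subst₂ (embed B) (sole (B⊆P b)) (sym ey) b)
    refute (in-only-seed refl ex ey sole empty) with percolates⇒seed B percB
    ... | _ , _ , flat o m with sole (B⊆P o)
    ...   | refl = removed (subst₂ (embed B) (sym ex) (sym ey) m)
    refute (in-only-seed refl ex ey sole empty) | _ , _ , up o m with sole (B⊆P o)
    ... | refl = empty-removed empty (_ , any , m)
    refute (in-only-seed refl ex ey sole empty) | _ , _ , down m o = contradiction (sole (B⊆P o)) λ ()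

Occupied : (ℕ → Column) → Kind → ℕ → Set
Occupied P K = N (λ x y → P x y ≡ true) K

tail-gapless : ∀ {r K} → r ∈ᴷ K → ∀ x → Occupied (motif r []) K x ⊎ Occupied (motif r []) K (suc x)
tail-gapless {r} i 0 = inj₂ (r , i , dec-true (r ≟ᴿ r) refl)
tail-gapless {r} i 1 = inj₁ (r , i , dec-true (r ≟ᴿ r) refl)
tail-gapless {r} i 2 = inj₁ (r , i , dec-true (r ≟ᴿ r) refl)
tail-gapless i (suc (suc (suc x))) = tail-gapless i x

tail-last : ∀ {r K} → r ∈ᴷ K → ∀ k → Occupied (motif r []) K (2 + k * 3)
tail-last {r} i zero = r , i , dec-true (r ≟ᴿ r) refl
tail-last i (suc k) = tail-last i k

module _ {M n' : ℕ} (n≤3 : suc n' ≤ 3) (P : ℕ → Column) where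

  private
    A : VSet (suc M) (suc n')
    A = restrict P

  embed-restrict : ∀ {x j} → x ≤ M → j ≤ n' → P x (row j) ≡ true → embed A x (row j)
  embed-restrict {x} {j} x≤M j≤n' p = fromℕ< (s≤s x≤M) , fromℕ< (s≤s j≤n') , ex , cong row ej ,
    subst₂ (λ x j → P x (row j) ≡ true) (sym ex) (sym ej) p
    where
    ex = toℕ-fromℕ< (s≤s x≤M)
    ej = toℕ-fromℕ< (s≤s j≤n')

  module _ {K : Kind} (rows : ∀ {y} → y ∈ᴷ K → ∃ λ j → j ≤ n' × row j ≡ y) where

    N-restrict : ∀ {x} → x ≤ M → Occupied P K x → N (embed A) K x
    N-restrict x≤M (y , i , p) with rows i
    ... | j , j≤n' , refl = y , i , embed-restrict x≤M j≤n' p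

    Chain-restrict : Occupied P K 0 → Occupied P K M → (∀ x → Occupied P K x ⊎ Occupied P K (suc x)) →
                     Chain (N (embed A) K) 0 M
    Chain-restrict f l g = record
      { ordered = z≤n ; first = N-restrict z≤n f ; last = N-restrict ≤-refl l
      ; gapless = λ {x} _ x<M → [ inj₁ ∘ N-restrict (<⇒≤ x<M) , inj₂ ∘ N-restrict x<M ]′ (g x) }

  Span⇒Percolates : ∀ {K t} → (∀ {j} → j ≤ n' → row j ∈ᴷ K) → Span (embed A) K 0 M t → Percolates A
  Span⇒Percolates rows sp = Cl⇒Percolates n≤3 A (λ p → All.lookup (inside sp) p)
    (λ i j → spans sp z≤n (≤-pred (toℕ<n i)) (rows (≤-pred (toℕ<n j))))

  percolates-all : ∀ {x s} → (∀ y → ∃ λ j → j ≤ n' × row j ≡ y) → x ≤ M → P x (out s) ≡ true → P x (out (opp s)) ≡ true →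
                   Occupied P all 0 → Occupied P all M → (∀ x → Occupied P all x ⊎ Occupied P all (suc x)) → Percolates A
  percolates-all {x} {s} rows x≤M o o' f l g = Span⇒Percolates (λ _ → any)
    (opposite-pair s setup (at o) (at o'))
    where
    at : ∀ {y} → P x y ≡ true → embed A x y
    at {y} p with rows y
    ... | j , j≤n' , refl = embed-restrict x≤M j≤n' p
    setup : Setup (embed A) M
    setup = record { A? = embed-dec A ; bounded = embed-bounded A
                   ; linked = Chain-restrict (λ {y} _ → rows y) f l g }

count : ℕ → Column → ℕ
count n c = total {n} (λ j → if c (row (toℕ j)) then 1 else 0)

size-suc : ∀ m n P → size {suc m} {n} (restrict P) ≡ count n (P 0) + size {m} {n} (restrict (P ∘ suc))
size-suc m n P = total-suc {m} (λ i → count n (P (toℕ i)))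

size-tail : ∀ n r k → count n (only r) ≡ 1 → size {k * 3} {n} (restrict (motif r [])) ≡ k * 2
size-tail n r zero e = refl
size-tail n r (suc k) e = trans (size-suc (2 + k * 3) n P) (cong₂ _+_ (total-zero n)
  (trans (size-suc (1 + k * 3) n (λ x → P (1 + x))) (cong₂ _+_ e
    (trans (size-suc (k * 3) n (λ x → P (2 + x))) (cong₂ _+_ e (size-tail n r k e))))))
  where P = motif r []

/3-unique : ∀ r q → r < 3 → (r + q * 3) / 3 ≡ q
/3-unique r q r<3 = trans (+-distrib-/-∣ʳ r (n∣m*n q)) (cong₂ _+_ (m<n⇒m/n≡0 r<3) (m*n/n≡m q 3))

weight : ℕ → List Column → ℕ
weight n [] = 0
weight n (c ∷ cs) = count n c + weight n cs

size-pattern : ∀ n r cs k → count n (only r) ≡ 1 →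
               size {length cs + k * 3} {n} (restrict (motif r cs)) ≡ weight n cs + k * 2
size-pattern n r [] k e = size-tail n r k e
size-pattern n r (c ∷ cs) k e = trans (size-suc (length cs + k * 3) n (motif r (c ∷ cs)))
  (trans (cong (count n c +_) (size-pattern n r cs k e)) (sym (+-assoc (count n c) (weight n cs) (k * 2))))

Attained : ℕ → ℕ → Set
Attained m n = Σ (VSet m n) (λ A → MinimalPercolating A × size A ≡ (2 * (m + n)) / 3)

attain : ∀ {n'} (n≤3 : suc n' ≤ 3) r c cs k ρ → let P = motif r (c ∷ cs) ; m = suc (length cs) + k * 3 in
         count (suc n') (only r) ≡ 1 → ρ < 3 → 2 * (m + suc n') ≡ ρ + (weight (suc n') (c ∷ cs) + k * 2) * 3 →
         (∀ x {y} → P x y ≡ true → Essential (suc n') P x y) → Percolates {m} {suc n'} (restrict P) → Attained m (suc n')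
attain {n'} n≤3 r c cs k ρ e ρ<3 arith essential perc =
  restrict (motif r (c ∷ cs)) , essential⇒minimal n≤3 _ essential perc ,
  trans (size-pattern (suc n') r (c ∷ cs) k e)
        (sym (trans (cong (_/ 3) arith) (/3-unique ρ (weight (suc n') (c ∷ cs) + k * 2) ρ<3)))

only-lone : ∀ {r y y'} → only r y ≡ true → only r y' ≡ true → y' ≡ y
only-lone {r} p p' = trans (only-true {r} p') (sym (only-true {r} p))

module One where

  1≤3 : 1 ≤ 3
  1≤3 = s≤s z≤n

  T = out top

  percolates : ∀ {M} P → P 0 T ≡ true → Occupied P (one T) M →
               (∀ x → Occupied P (one T) x ⊎ Occupied P (one T) (suc x)) → Percolates {suc M} {1} (restrict P)
  percolates {M} P f l g = Span⇒Percolates 1≤3 P (λ { z≤n → single })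
    (extend (embed-dec A) M (+-identityʳ M) z≤n
      (Chain-restrict 1≤3 P (λ { single → 0 , z≤n , refl }) (T , single , f) l g)
      (point-span (embed-restrict 1≤3 P z≤n z≤n f)))
    where
    A : VSet (suc M) 1
    A = restrict P

  attained₁ : ∀ k → Attained (1 + k * 3) 1
  attained₁ k = attain 1≤3 T (only T) [] k 1 refl (s≤s (s≤s z≤n)) (arith k)
    (λ { 0 p → first-column refl (only-lone {T} p)
       ; (suc x) p → next-to-gap (next-shift (tail-next x p)) })
    (percolates (motif T (only T ∷ [])) refl (last-column k)
      λ { 0 → inj₁ (T , single , refl) ; (suc x) → tail-gapless single x })
    where
    arith : ∀ k → 2 * (1 + k * 3 + 1) ≡ 1 + (1 + k * 2) * 3
    arith = solve-∀
    last-column : ∀ k → Occupied (motif T (only T ∷ [])) (one T) (k * 3)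
    last-column zero = T , single , refl
    last-column (suc k) = tail-last single k

  attained₂ : ∀ k → Attained (2 + k * 3) 1
  attained₂ k = attain 1≤3 T (only T) (only T ∷ []) k 0 refl (s≤s z≤n) (arith k)
    (λ { 0 p → first-column refl (only-lone {T} p)
       ; 1 p → next-to-gap (only-lone {T} p , inj₁ λ _ → refl)
       ; (suc (suc x)) p → next-to-gap (next-shift (next-shift (tail-next x p))) })
    (percolates (motif T (only T ∷ only T ∷ [])) refl (last-column k)
      λ { 0 → inj₁ (T , single , refl) ; 1 → inj₁ (T , single , refl) ; (suc (suc x)) → tail-gapless single x })
    where
    arith : ∀ k → 2 * (2 + k * 3 + 1) ≡ (2 + k * 2) * 3
    arith = solve-∀
    last-column : ∀ k → Occupied (motif T (only T ∷ only T ∷ [])) (one T) (1 + k * 3)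
    last-column zero = T , single , refl
    last-column (suc k) = tail-last single k

  attained₃ : ∀ k → Attained (3 + k * 3) 1
  attained₃ k = attain 1≤3 T (only T) (none ∷ only T ∷ []) k 2 refl (s≤s (s≤s (s≤s z≤n))) (arith k)
    (λ { 0 p → first-column refl (only-lone {T} p)
       ; 1 ()
       ; 2 p → next-to-gap (only-lone {T} p , inj₁ λ _ → refl)
       ; (suc (suc (suc x))) p → next-to-gap (next-shift (next-shift (next-shift (tail-next x p)))) })
    (percolates (motif T (only T ∷ none ∷ only T ∷ [])) refl (last-column k)
      λ { 0 → inj₁ (T , single , refl) ; 1 → inj₂ (T , single , refl) ; 2 → inj₁ (T , single , refl)
        ; (suc (suc (suc x))) → tail-gapless single x })
    where
    arith : ∀ k → 2 * (3 + k * 3 + 1) ≡ 2 + (2 + k * 2) * 3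
    arith = solve-∀
    last-column : ∀ k → Occupied (motif T (only T ∷ none ∷ only T ∷ [])) (one T) (2 + k * 3)
    last-column zero = T , single , refl
    last-column (suc k) = tail-last single k

tail-mid : ∀ x s → motif mid [] x (out s) ≢ true
tail-mid x s e = contradiction (only-true {mid} {out s} (∧-true {tail x} e)) λ ()

module Two where

  2≤3 : 2 ≤ 3
  2≤3 = s≤s (s≤s z≤n)

  T = out top
  K = two top

  rows : ∀ {y} → y ∈ᴷ K → ∃ λ j → j ≤ 1 × row j ≡ y
  rows outer = 0 , z≤n , refl
  rows middle = 1 , s≤s z≤n , refl

  percolates : ∀ {M q t} P → Span (embed {suc M} {2} (restrict P)) K 0 q t → q ≤ M → Occupied P K 0 → Occupied P K M →
               (∀ x → Occupied P K x ⊎ Occupied P K (suc x)) → Percolates {suc M} {2} (restrict P)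
  percolates {M} {q} P sp q≤M f l g = Span⇒Percolates 2≤3 P (λ { z≤n → outer ; (s≤s z≤n) → middle })
    (extend (embed-dec {suc M} {2} (restrict P)) (M ∸ q) (m∸n+n≡m q≤M) z≤n (Chain-restrict 2≤3 P rows f l g) sp)

  at : ∀ {M y} (P : ℕ → Column) x → y ∈ᴷ K → x ≤ M → P x y ≡ true → embed {suc M} {2} (restrict P) x y
  at P x i x≤M p with rows i
  ... | j , j≤1 , refl = embed-restrict 2≤3 P x≤M j≤1 p

  attained₁ : ∀ k → Attained (1 + k * 3) 2
  attained₁ k = attain 2≤3 mid upper [] k 0 refl (s≤s z≤n) (arith k)
    (λ { 0 {out top} p → sole-in-row refl sole
       ; 0 {mid} p → in-only-seed refl refl refl sole λ _ → refl
       ; 0 {out bot} ()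
       ; (suc x) p → next-to-gap (next-shift (tail-next x p)) })
    (percolates P (flat-span (at P 0 outer z≤n refl) (at P 0 middle z≤n refl)) z≤n (mid , middle , refl) (last-column k)
      λ { 0 → inj₁ (mid , middle , refl) ; (suc x) → tail-gapless middle x })
    where
    P = motif mid (upper ∷ [])
    sole : ∀ {x} → P x T ≡ true → x ≡ 0
    sole {zero} _ = refl
    sole {suc x} e = ⊥-elim (tail-mid x top e)
    arith : ∀ k → 2 * (1 + k * 3 + 2) ≡ (2 + k * 2) * 3
    arith = solve-∀
    last-column : ∀ k → Occupied P K (k * 3)
    last-column zero = mid , middle , refl
    last-column (suc k) = tail-last middle k

  attained₂ : ∀ k → Attained (2 + k * 3) 2
  attained₂ k = attain 2≤3 mid (only T) (only mid ∷ []) k 2 refl (s≤s (s≤s (s≤s z≤n))) (arith k)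
    (λ { 0 p → sole-in-row (only-true {T} p) sole
       ; 1 p → next-to-gap (only-lone {mid} p , inj₁ λ _ → refl)
       ; (suc (suc x)) p → next-to-gap (next-shift (next-shift (tail-next x p))) })
    (percolates P (diagonal-span out~mid outer middle (at P 0 outer z≤n refl) (at P 1 middle (s≤s z≤n) refl)) (s≤s z≤n)
      (T , outer , refl) (last-column k)
      λ { 0 → inj₁ (T , outer , refl) ; 1 → inj₁ (mid , middle , refl) ; (suc (suc x)) → tail-gapless middle x })
    where
    P = motif mid (only T ∷ only mid ∷ [])
    sole : ∀ {x} → P x T ≡ true → x ≡ 0
    sole {zero} _ = refl
    sole {suc (suc x)} e = ⊥-elim (tail-mid x top e)
    arith : ∀ k → 2 * (2 + k * 3 + 2) ≡ 2 + (2 + k * 2) * 3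
    arith = solve-∀
    last-column : ∀ k → Occupied P K (1 + k * 3)
    last-column zero = mid , middle , refl
    last-column (suc k) = tail-last middle k

  attained₃ : ∀ k → Attained (3 + k * 3) 2
  attained₃ k = attain 2≤3 mid (only mid) (only T ∷ only mid ∷ []) k 1 refl (s≤s (s≤s z≤n)) (arith k)
    (λ { 0 p → first-column refl (only-lone {mid} p)
       ; 1 p → sole-in-row (only-true {T} p) sole
       ; 2 p → next-to-gap (only-lone {mid} p , inj₁ λ _ → refl)
       ; (suc (suc (suc x))) p → next-to-gap (next-shift (next-shift (next-shift (tail-next x p)))) })
    (percolates P (diagonal-span mid~out middle outer (at P 0 middle z≤n refl) (at P 1 outer (s≤s z≤n) refl)) (s≤s z≤n)
      (mid , middle , refl) (last-column k)
      λ { 0 → inj₁ (mid , middle , refl) ; 1 → inj₁ (T , outer , refl) ; 2 → inj₁ (mid , middle , refl)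
        ; (suc (suc (suc x))) → tail-gapless middle x })
    where
    P = motif mid (only mid ∷ only T ∷ only mid ∷ [])
    sole : ∀ {x} → P x T ≡ true → x ≡ 1
    sole {1} _ = refl
    sole {suc (suc (suc x))} e = ⊥-elim (tail-mid x top e)
    arith : ∀ k → 2 * (3 + k * 3 + 2) ≡ 1 + (3 + k * 2) * 3
    arith = solve-∀
    last-column : ∀ k → Occupied P K (2 + k * 3)
    last-column zero = mid , middle , refl
    last-column (suc k) = tail-last middle k

module Three where

  rows : ∀ y → ∃ λ j → j ≤ 2 × row j ≡ y
  rows (out top) = 0 , z≤n , refl
  rows mid = 1 , s≤s z≤n , refl
  rows (out bot) = 2 , ≤-refl , refl

  attained₁ : ∀ k → Attained (1 + k * 3) 3
  attained₁ k = attain ≤-refl mid outers [] k 2 refl (s≤s (s≤s (s≤s z≤n))) (arith k)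
    (λ { 0 {out s} p → sole-in-row refl sole
       ; 0 {mid} ()
       ; (suc x) p → next-to-gap (next-shift (tail-next x p)) })
    (percolates-all ≤-refl P {s = top} rows z≤n refl refl (out top , any , refl) (last-column k)
      λ { 0 → inj₁ (out top , any , refl) ; (suc x) → tail-gapless any x })
    where
    P = motif mid (outers ∷ [])
    sole : ∀ {s x} → P x (out s) ≡ true → x ≡ 0
    sole {_} {zero} _ = refl
    sole {s} {suc x} e = ⊥-elim (tail-mid x s e)
    arith : ∀ k → 2 * (1 + k * 3 + 3) ≡ 2 + (2 + k * 2) * 3
    arith = solve-∀
    last-column : ∀ k → Occupied P all (k * 3)
    last-column zero = out top , any , refl
    last-column (suc k) = tail-last any k

  attained₂ : ∀ k → Attained (2 + k * 3) 3
  attained₂ k = attain ≤-refl mid outers (only mid ∷ []) k 1 refl (s≤s (s≤s z≤n)) (arith k)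
    (λ { 0 {out s} p → sole-in-row refl sole
       ; 0 {mid} ()
       ; 1 p → next-to-gap (only-lone {mid} p , inj₁ λ _ → refl)
       ; (suc (suc x)) p → next-to-gap (next-shift (next-shift (tail-next x p))) })
    (percolates-all ≤-refl P {s = top} rows z≤n refl refl (out top , any , refl) (last-column k)
      λ { 0 → inj₁ (out top , any , refl) ; 1 → inj₁ (mid , any , refl) ; (suc (suc x)) → tail-gapless any x })
    where
    P = motif mid (outers ∷ only mid ∷ [])
    sole : ∀ {s x} → P x (out s) ≡ true → x ≡ 0
    sole {_} {zero} _ = refl
    sole {s} {suc (suc x)} e = ⊥-elim (tail-mid x s e)
    arith : ∀ k → 2 * (2 + k * 3 + 3) ≡ 1 + (3 + k * 2) * 3
    arith = solve-∀
    last-column : ∀ k → Occupied P all (1 + k * 3)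
    last-column zero = mid , any , refl
    last-column (suc k) = tail-last any k

  attained₃ : ∀ k → Attained (3 + k * 3) 3
  attained₃ k = attain ≤-refl mid (only mid) (outers ∷ only mid ∷ []) k 0 refl (s≤s z≤n) (arith k)
    (λ { 0 p → first-column refl (only-lone {mid} p)
       ; 1 {out s} p → sole-in-row refl sole
       ; 1 {mid} ()
       ; 2 p → next-to-gap (only-lone {mid} p , inj₁ λ _ → refl)
       ; (suc (suc (suc x))) p → next-to-gap (next-shift (next-shift (next-shift (tail-next x p)))) })
    (percolates-all ≤-refl P {x = 1} {s = top} rows (s≤s z≤n) refl refl (mid , any , refl) (last-column k)
      λ { 0 → inj₁ (mid , any , refl) ; 1 → inj₁ (out top , any , refl) ; 2 → inj₁ (mid , any , refl)
        ; (suc (suc (suc x))) → tail-gapless any x })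
    where
    P = motif mid (only mid ∷ outers ∷ only mid ∷ [])
    sole : ∀ {s x} → P x (out s) ≡ true → x ≡ 1
    sole {_} {1} _ = refl
    sole {s} {suc (suc (suc x))} e = ⊥-elim (tail-mid x s e)
    arith : ∀ k → 2 * (3 + k * 3 + 3) ≡ (4 + k * 2) * 3
    arith = solve-∀
    last-column : ∀ k → Occupied P all (2 + k * 3)
    last-column zero = mid , any , refl
    last-column (suc k) = tail-last any k

residues : ∀ {Q : ℕ → Set} → (∀ k → Q (1 + k * 3)) → (∀ k → Q (2 + k * 3)) → (∀ k → Q (3 + k * 3)) →
           ∀ M → Q (suc M)
residues q₁ q₂ q₃ 0 = q₁ 0
residues q₁ q₂ q₃ 1 = q₂ 0
residues q₁ q₂ q₃ 2 = q₃ 0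
residues {Q} q₁ q₂ q₃ (suc (suc (suc M))) =
  residues {λ m → Q (3 + m)} (q₁ ∘ suc) (q₂ ∘ suc) (q₃ ∘ suc) M

theorem4p1 : ∀ (m : ℕ) → 1 ≤ m →
    IsE m 1 ((2 * (m + 1)) / 3) × IsE m 2 ((2 * (m + 2)) / 3) × IsE m 3 ((2 * (m + 3)) / 3)
theorem4p1 (suc M) _ =
  (residues {λ m → Attained m 1} One.attained₁ One.attained₂ One.attained₃ M , upper-one M) ,
  (residues {λ m → Attained m 2} Two.attained₁ Two.attained₂ Two.attained₃ M , upper-two M) ,
  (residues {λ m → Attained m 3} Three.attained₁ Three.attained₂ Three.attained₃ M , upper-three M)
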